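{- Let $Q\subseteq\mathbb N$ be an infinite set, and let $\{G_q\}_{q\in Q}$ be a family of graphs such that, for each $q\in Q$, $G_q$ is strongly regular with parameters $(v(q),k(q),\lambda(q),\mu(q))$, where $v,k,\lambda,\mu\in\mathbb Q[q]$ are polynomials. Let $\psi_{G_q}(x)$ be the characteristic polynomial of the adjacency matrix of $G_q$, and write $$\psi_{G_q}(x)=\sum_{r=0}^{v(q)}c_r(q)x^{v(q)-r},\qquad c_r(q)=0\ \text{ for } r>v(q).$$ Then for every $r\ge 0$ there is a polynomial $\varphi_r$ such that $c_r(q)=\varphi_r(q)$ for all $q\in Q$. Thus the characteristic polynomials $\{\psi_{G_q}\}_{q\in Q}$ form a two-level polynomial over $Q$ with degree function $v$ and infinite depth.
   Context: A graph $G$ (finite, simple) is strongly regular with parameters $(v,k,\lambda,\mu)$ if it has $v$ vertices, is $k$-regular, every two adjacent vertices have exactly $\lambda$ common neighbors, and every two (distinct) non-adjacent vertices have exactly $\mu$ common neighbors. Two-level polynomial over $Q$: let $Q\subseteq\mathbb N$ be infinite, let $g\in\mathbb Q[q]$ take nonnegative integer values on $Q$, and let $e:Q\to\mathbb N\cup\{ -1,\infty\}$. A family of polynomials $(f_q(n))_{q\in Q}$ is a two-level polynomial over $Q$ of degree function $g$ and depth function $e$ if $f_q(n)$ has degree $g(q)$ for each $q \in Q$ and, writing $f_q(n)=\sum_{r=0}^{\infty}c_r(q)n^{g(q)-r}$ with $c_r(q)=0$ for $r>g(q)$, there exist polynomials $\{\varphi_r(q)\}_{r\ge0}$ such that $c_r(q)=\varphi_r(q)$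 for every $q\in Q$ and every $r\le e(q)$. Infinite depth means $e(q)=\infty$ for all $q\in Q$. -}

module Defs where

open import Algebra.Bundles.Raw using (RawRing)
import Algebra.Definitions.RawSemiring as RawSemiringDefs
open import Data.Bool.Base using (if_then_else_)
open import Data.Fin.Base using (Fin; zero; suc; toℕ; punchIn)
import Data.Fin.Properties as Fin
open import Data.Fin.Subset using (Subset; ∣_∣; _∩_)
open import Data.Integer.Base using (+_)
open import Data.List.Base using (List; []; _∷_; map; foldr)
open import Data.Nat.Base as ℕ using (ℕ; zero; suc; _∸_)
import Data.Nat.Properties as ℕ
open import Data.Nat.InfinitelyOften using (Inf)
open import Data.Product.Base using (∃-syntax; _×_)
open import Data.Rational.Base as ℚ using (ℚ; 0ℚ; 1ℚ)
open import Data.Rational.Literals using (fromℤ)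
open import Data.Vec.Base using (tabulate)
open import Level using (Level; 0ℓ)
open import Relation.Binary.Construct.Add.Extrema.NonStrict ℕ._≤_ using (_≤±_)
open import Relation.Binary.Core using (Rel)
open import Relation.Binary.Definitions using (Decidable; Symmetric; Irreflexive)
open import Relation.Binary.PropositionalEquality.Core using (_≡_; _≢_)
open import Relation.Nullary.Construct.Add.Extrema using (_±; [_])
open import Relation.Nullary.Decidable.Core using (does)
open import Relation.Nullary.Negation.Core using (¬_)
open import Relation.Unary using (Pred; _∈_)

fromℕ : ℕ → ℚ
fromℕ n = fromℤ (+ n)

-- A polynomial is its list of coefficients, constant term first.  Trailing
-- zeros are allowed, so equality of polynomials is _≈ᴾ_ and not _≡_.
Polynomial : Set
Polynomial = List ℚ

coeff : Polynomial → ℕ → ℚ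
coeff []      _       = 0ℚ
coeff (a ∷ _) zero    = a
coeff (_ ∷ p) (suc i) = coeff p i

infix 4 _≈ᴾ_

_≈ᴾ_ : Rel Polynomial 0ℓ
p ≈ᴾ q = ∀ i → coeff p i ≡ coeff q i

eval : Polynomial → ℚ → ℚ
eval p x = foldr (λ a y → a ℚ.+ x ℚ.* y) 0ℚ p

HasDegree : Polynomial → ℕ → Set
HasDegree p d = coeff p d ≢ 0ℚ × (∀ i → d ℕ.< i → coeff p i ≡ 0ℚ)

infixl 6 _+ᴾ_
infixl 7 _*ᴾ_

_+ᴾ_ : Polynomial → Polynomial → Polynomial
[]      +ᴾ q       = q
(a ∷ p) +ᴾ []      = a ∷ p
(a ∷ p) +ᴾ (b ∷ q) = (a ℚ.+ b) ∷ (p +ᴾ q)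

-ᴾ_ : Polynomial → Polynomial
-ᴾ p = map ℚ.-_ p

_*ᴾ_ : Polynomial → Polynomial → Polynomial
[]      *ᴾ q = []
(a ∷ p) *ᴾ q = map (a ℚ.*_) q +ᴾ (0ℚ ∷ (p *ᴾ q))

constant : ℚ → Polynomial
constant a = a ∷ []

indeterminate : Polynomial
indeterminate = 0ℚ ∷ 1ℚ ∷ []

polynomialRawRing : RawRing 0ℓ 0ℓ
polynomialRawRing = record
  { Carrier = Polynomial
  ; _≈_     = _≈ᴾ_
  ; _+_     = _+ᴾ_
  ; _*_     = _*ᴾ_
  ; -_      = -ᴾ_
  ; 0#      = []
  ; 1#      = constant 1ℚ
  }

-- The coefficient of x^(d - r) in p, read as 0 when r > d.
coeffFromTop : ℕ → Polynomial → ℕ → ℚ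
coeffFromTop d p r = if does (r ℕ.≤? d) then coeff p (d ∸ r) else 0ℚ

Matrix : ∀ {a} → Set a → ℕ → Set a
Matrix A n = Fin n → Fin n → A

module _ {a ℓ} (R : RawRing a ℓ) where

  open RawRing R
  open RawSemiringDefs rawSemiring using (sum; _^_)

  -- Laplace expansion along the first row.
  det : ∀ {n} → Matrix Carrier n → Carrier
  det {zero}  M = 1#
  det {suc n} M =
    sum λ j → (- 1#) ^ toℕ j * M zero j * det (λ i k → M (suc i) (punchIn j k))

charPoly : ∀ {n} → Matrix ℚ n → Polynomial
charPoly A = det polynomialRawRing λ i j →
  (if does (i Fin.≟ j) then indeterminate else []) +ᴾ (-ᴾ constant (A i j))

record Graph : Set₁ where
  infix 4 _∼_ _∼?_
  field
    order    : ℕ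
    _∼_      : Rel (Fin order) 0ℓ
    _∼?_     : Decidable _∼_
    ∼-sym    : Symmetric _∼_
    ∼-irrefl : Irreflexive _≡_ _∼_

  neighbours : Fin order → Subset order
  neighbours u = tabulate λ w → does (u ∼? w)

  adjacencyMatrix : Matrix ℚ order
  adjacencyMatrix u w = if does (u ∼? w) then 1ℚ else 0ℚ

graphCharPoly : Graph → Polynomial
graphCharPoly G = charPoly (Graph.adjacencyMatrix G)

record IsStronglyRegular (G : Graph) (v k l m : ℕ) : Set where
  open Graph G
  field
    order≡v     : order ≡ v
    regular     : ∀ u → ∣ neighbours u ∣ ≡ k
    adjacent    : ∀ u w → u ∼ w → ∣ neighbours u ∩ neighbours w ∣ ≡ l
    nonadjacent : ∀ u w → u ≢ w → ¬ u ∼ w → ∣ neighbours u ∩ neighbours w ∣ ≡ m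

-- The parameters are values at q of rational polynomials; being parameters of
-- a graph, these values are natural numbers.
IsStronglyRegularAt : Graph → (v k l m : Polynomial) → ℕ → Set
IsStronglyRegularAt G v k l m q =
  ∃[ v′ ] ∃[ k′ ] ∃[ l′ ] ∃[ m′ ]
    ( eval v (fromℕ q) ≡ fromℕ v′
    × eval k (fromℕ q) ≡ fromℕ k′
    × eval l (fromℕ q) ≡ fromℕ l′
    × eval m (fromℕ q) ≡ fromℕ m′
    × IsStronglyRegular G v′ k′ l′ m′ )

-- Families indexed by Q take the membership proof as an argument, because for
-- an undecidable Q a family on Q need not extend to all of ℕ.  Depths live in
-- ℕ ±, whose bottom ⊥± plays the role of -1 and whose top ⊤± that of ∞.
record TwoLevelPolynomial {ℓ : Level} (Q : Pred ℕ ℓ)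
                          (f : ∀ q → q ∈ Q → Polynomial)
                          (g : Polynomial)
                          (e : ∀ q → q ∈ Q → ℕ ±) : Set ℓ where
  field
    Q-infinite : Inf Q
    degree     : ∀ q → q ∈ Q → ℕ
    g-value    : ∀ q (q∈Q : q ∈ Q) → eval g (fromℕ q) ≡ fromℕ (degree q q∈Q)
    f-degree   : ∀ q (q∈Q : q ∈ Q) → HasDegree (f q q∈Q) (degree q q∈Q)
    φ          : ℕ → Polynomial
    f-coeff    : ∀ q (q∈Q : q ∈ Q) r → [ r ] ≤± e q q∈Q →
                 coeffFromTop (degree q q∈Q) (f q q∈Q) r ≡ eval (φ r) (fromℕ q)

{-# OPTIONS --safe #-}
module Submission where

-- Write A² = t I + s A + m J with t = k − m and s = l − m.  For
-- N = (x − k)(x − s) I + (x − k) A + m J one has (x I − A) N = P I, where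
-- P = (x − k)(x (x − s) − t).  Differentiating χ = det (x I − A) column by column
-- and replacing P e_c by the combination of the columns of x I − A given by N,
-- alternation leaves P χ′ = (tr N) χ with tr N = v ((x − k)(x − s) + m).
-- Comparing coefficients expresses r c_r through c_{r−1}, c_{r−2} and c_{r−3}
-- with coefficients that are polynomials in v, k, l, m and r.

open import Defs
open import Algebra.Bundles using (CommutativeRing)
open import Algebra.Bundles.Raw using (RawRing)
import Algebra.Definitions.RawMonoid
import Algebra.Definitions.RawSemiring
import Algebra.Properties.Monoid.Mult
import Algebra.Properties.Ring
import Algebra.Properties.Semiring.Sum
open import Data.Bool.Base using (true; false; if_then_else_; _∧_)
open import Data.Fin.Base using (Fin; zero; suc; toℕ; inject₁; punchIn; punchOut)
import Data.Fin.Properties as Fin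
open import Data.Fin.Subset using (Subset; ∣_∣; _∩_)
import Data.Fin.Subset.Properties as Subset
import Data.Integer.Base as ℤ
import Data.Integer.Properties as ℤ
open import Data.List.Base using ([]; _∷_; map)
open import Data.Nat.Base as ℕ using (ℕ; zero; suc; z≤n; s≤s)
open import Data.Nat.InfinitelyOften using (Inf)
import Data.Nat.Properties as ℕ
open import Data.Product.Base using (∃-syntax; _×_; _,_; proj₁; proj₂)
open import Data.Rational.Base as ℚ using (ℚ; 0ℚ; 1ℚ)
import Data.Rational.Properties as ℚ
open import Data.Rational.Solver using (module +-*-Solver)
import Data.Rational.Unnormalised.Base as ℚᵘ
import Data.Rational.Unnormalised.Properties as ℚᵘ
open import Data.Sum.Base using (_⊎_; inj₁; inj₂)
open import Data.Vec.Base using (lookup; []; _∷_)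
import Data.Vec.Properties as Vec
open import Function.Base using (_∘_)
open import Function.Bundles using (mk⇔)
open import Level using (0ℓ)
open import Relation.Binary.Definitions using (tri<; tri≈; tri>)
open import Relation.Binary.PropositionalEquality.Core as ≡ using (_≡_; _≢_)
open import Relation.Binary.PropositionalEquality.Properties using (module ≡-Reasoning)
open import Relation.Nullary.Construct.Add.Extrema using (⊤±)
open import Relation.Nullary.Decidable using (does-⇔; dec-false)
open import Relation.Nullary.Decidable.Core using (does; yes; no)
open import Relation.Nullary.Negation.Core using (contradiction)
open import Relation.Unary using (Pred; _∈_)

-- The eigenvalues other than k are the roots of x (x - s) - t, which may be irrational, and closed
-- formulas for their multiplicities contain the square root of the discriminant. A differential
-- equation for χ whose coefficients are themselves polynomial in the parameters avoids the spectrum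
-- altogether. The matrix N comes from (x I - A)((x - s) I + A) = (x (x - s) - t) I - m J and (x I -
-- A) J = (x - k) J: multiplying the first identity by x - k and adding m times the second cancels
-- J. Its trace depends on v and the parameters alone because A has zero diagonal. The index v - r
-- of c_r varies with q and may be negative. The equation is therefore carried over to x^r χ, in
-- which c_r always stands at x^v. The derivative is taken as θ = x d/dx, which multiplies each
-- coefficient by its own index and shifts nothing. In the comparison the terms v c_r on the two
-- sides cancel, and the remaining factor r is invertible in ℚ for r > 0, so c_r is determined by
-- its predecessors and c_0 = 1.

module FiniteSums {r ℓ} (R : CommutativeRing r ℓ) where

  open CommutativeRing R hiding (zero)
  open import Relation.Binary.Reasoning.Setoid setoid
  open Algebra.Properties.Semiring.Sum semiring public

  δ : ∀ {n} → Fin n → Fin n → Carrier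
  δ i j = if does (i Fin.≟ j) then 1# else 0#

  δ-refl : ∀ {n} (i : Fin n) → δ i i ≡ 1#
  δ-refl i with i Fin.≟ i
  ... | yes _  = ≡.refl
  ... | no i≢i = contradiction ≡.refl i≢i

  δ-≢ : ∀ {n} {i j : Fin n} → i ≢ j → δ i j ≡ 0#
  δ-≢ {i = i} {j} i≢j with i Fin.≟ j
  ... | yes i≡j = contradiction i≡j i≢j
  ... | no _    = ≡.refl

  sum-zero : ∀ {n} {f : Fin n → Carrier} → (∀ i → f i ≈ 0#) → sum f ≈ 0#
  sum-zero {n} f≈0 = trans (sum-cong-≋ f≈0) (sum-replicate-zero n)

  sum-supported : ∀ {n} (f : Fin n → Carrier) i →
                  (∀ j → j ≢ i → f j ≈ 0#) → sum f ≈ f i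
  sum-supported {suc n} f i f≈0 = begin
    sum f                      ≈⟨ sum-remove f ⟩
    f i + sum (f ∘ punchIn i)  ≈⟨ +-congˡ (sum-zero λ j → f≈0 (punchIn i j) (Fin.punchInᵢ≢i i j)) ⟩
    f i + 0#                   ≈⟨ +-identityʳ (f i) ⟩
    f i                        ∎

  sum-δ : ∀ {n} (f : Fin n → Carrier) i → sum (λ j → f j * δ i j) ≈ f i
  sum-δ f i = begin
    sum (λ j → f j * δ i j)  ≈⟨ sum-supported _ i (λ j j≢i → trans (*-congˡ (reflexive (δ-≢ (j≢i ∘ ≡.sym)))) (zeroʳ (f j))) ⟩
    f i * δ i i              ≈⟨ *-congˡ (reflexive (δ-refl i)) ⟩
    f i * 1#                 ≈⟨ *-identityʳ (f i) ⟩
    f i                      ∎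

-- Determinants

-- Alternation is proved for neighbouring columns before arbitrary ones. The inductive form follows
-- the recursion of `punchIn` and `punchOut`, so that passing to a minor is a matter of pattern
-- matching.
data Adjacent : ∀ {n} → Fin n → Fin n → Set where
  here  : ∀ {n} → Adjacent {suc (suc n)} zero (suc zero)
  there : ∀ {n} {a b : Fin n} → Adjacent a b → Adjacent (suc a) (suc b)

adjacent-inject₁ : ∀ {n} (a : Fin n) → Adjacent (inject₁ a) (suc a)
adjacent-inject₁ zero    = here
adjacent-inject₁ (suc a) = there (adjacent-inject₁ a)

adjacent-≢ : ∀ {n} {a b : Fin n} → Adjacent a b → a ≢ b
adjacent-≢ (there p) ≡.refl = adjacent-≢ p ≡.refl

-- No index lies strictly between `a` and `b`, so deleting an index outside the pair shifts both or
-- only numbers above them and cannot separate them.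
adjacent-punchOut : ∀ {n} {a b j : Fin (suc n)} (j≢a : j ≢ a) (j≢b : j ≢ b) →
                    Adjacent a b → Adjacent (punchOut j≢a) (punchOut j≢b)
adjacent-punchOut {j = zero}          j≢a j≢b here      = contradiction ≡.refl j≢a
adjacent-punchOut {j = zero}          j≢a j≢b (there p) = p
adjacent-punchOut {j = suc zero}      j≢a j≢b here      = contradiction ≡.refl j≢b
adjacent-punchOut {suc (suc n)} {j = suc (suc j)} j≢a j≢b here = here
adjacent-punchOut {suc n} {j = suc j} j≢a j≢b (there p) =
  there (adjacent-punchOut (j≢a ∘ ≡.cong suc) (j≢b ∘ ≡.cong suc) p)

-- The selections of columns that omit `a` and `b` differ in a single position, where one keeps `b`
-- and the other `a`. If these columns are equal, so are the two minors.
adjacent-punchIn : ∀ {n} {a b : Fin (suc n)} → Adjacent a b → ∀ k →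
                   punchIn a k ≡ punchIn b k ⊎ (punchIn a k ≡ b × punchIn b k ≡ a)
adjacent-punchIn here      zero    = inj₂ (≡.refl , ≡.refl)
adjacent-punchIn here      (suc k) = inj₁ ≡.refl
adjacent-punchIn (there p) zero    = inj₁ ≡.refl
adjacent-punchIn (there p) (suc k) with adjacent-punchIn p k
... | inj₁ eq        = inj₁ (≡.cong suc eq)
... | inj₂ (eq , eq′) = inj₂ (≡.cong suc eq , ≡.cong suc eq′)

module Determinant {r ℓ} (R : CommutativeRing r ℓ) where

  open CommutativeRing R hiding (zero)
  open Algebra.Properties.Ring ring using (-‿distribˡ-*; +-identityʳ-unique)
  open Algebra.Definitions.RawSemiring (RawRing.rawSemiring rawRing) using (_^_)
  open FiniteSums R
  open import Algebra.Solver.Ring.NaturalCoefficients.Default commutativeSemiring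
    using (solve; _:=_; _:+_; _:*_)
  open import Relation.Binary.Reasoning.Setoid setoid

  Mat : ℕ → Set r
  Mat = Matrix Carrier

  det′ : ∀ {n} → Mat n → Carrier
  det′ = det rawRing

  sign : ∀ {n} → Fin n → Carrier
  sign j = (- 1#) ^ toℕ j

  minor : ∀ {n} → Mat (suc n) → Fin (suc n) → Mat n
  minor M j i k = M (suc i) (punchIn j k)

  det-cong : ∀ {n} {M N : Mat n} → (∀ i j → M i j ≈ N i j) → det′ M ≈ det′ N
  det-cong {zero}  M≈N = refl
  det-cong {suc n} M≈N = sum-cong-≋ λ j →
    *-cong (*-congˡ {sign j} (M≈N zero j)) (det-cong λ i k → M≈N (suc i) (punchIn j k))

  punchIn-≢ : ∀ {n} {j c : Fin (suc n)} (j≢c : j ≢ c) {k} → k ≢ punchOut j≢c → punchIn j k ≢ c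
  punchIn-≢ {j = j} j≢c k≢c eq =
    k≢c (Fin.punchIn-injective j _ _ (≡.trans eq (≡.sym (Fin.punchIn-punchOut j≢c))))

  -- Additivity and homogeneity share one induction. In the term `j ≡ c` the entry splits and the
  -- minors agree; in every other term the entry is common and the minor is linear in the column
  -- that `c` becomes. Entrywise hypotheses, unlike an explicit column replacement, pass to minors
  -- directly.
  det-linear : ∀ {n} {M N L : Mat n} c x y →
               (∀ i → M i c ≈ x * N i c + y * L i c) →
               (∀ i {j} → j ≢ c → M i j ≈ N i j) →
               (∀ i {j} → j ≢ c → M i j ≈ L i j) →
               det′ M ≈ x * det′ N + y * det′ L
  det-linear {suc n} {M} {N} {L} c x y atc N-off L-off = begin
    sum (term M)                                   ≈⟨ sum-cong-≋ each ⟩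
    sum (λ j → x * term N j + y * term L j)        ≈⟨ ∑-distrib-+ (λ j → x * term N j) (λ j → y * term L j) ⟩
    sum (λ j → x * term N j) + sum (λ j → y * term L j)
      ≈⟨ +-cong (*-distribˡ-sum x (term N)) (*-distribˡ-sum y (term L)) ⟨
    x * sum (term N) + y * sum (term L)            ∎
    where
    term : Mat (suc n) → Fin (suc n) → Carrier
    term K j = sign j * K zero j * det′ (minor K j)
    each : ∀ j → term M j ≈ x * term N j + y * term L j
    each j with j Fin.≟ c
    ... | yes ≡.refl = begin
      sign j * M zero j * det′ (minor M j)  ≈⟨ *-congʳ (*-congˡ (atc zero)) ⟩
      sign j * (x * N zero j + y * L zero j) * det′ (minor M j)
        ≈⟨ solve 6 (λ s x y n l d → s :* (x :* n :+ y :* l) :* d := x :* (s :* n :* d) :+ y :* (s :* l :* d)) refl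
             (sign j) x y (N zero j) (L zero j) (det′ (minor M j)) ⟩
      x * (sign j * N zero j * det′ (minor M j)) + y * (sign j * L zero j * det′ (minor M j))
        ≈⟨ +-cong (*-congˡ (*-congˡ (det-cong λ i k → N-off (suc i) (Fin.punchInᵢ≢i j k))))
                  (*-congˡ (*-congˡ (det-cong λ i k → L-off (suc i) (Fin.punchInᵢ≢i j k)))) ⟩
      x * term N j + y * term L j  ∎
    ... | no j≢c = begin
      sign j * M zero j * det′ (minor M j)
        ≈⟨ *-congˡ (det-linear (punchOut j≢c) x y
             (λ i → ≡.subst (λ b → M (suc i) b ≈ x * N (suc i) b + y * L (suc i) b)
                      (≡.sym (Fin.punchIn-punchOut j≢c)) (atc (suc i)))
             (λ i k≢c → N-off (suc i) (punchIn-≢ j≢c k≢c))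
             (λ i k≢c → L-off (suc i) (punchIn-≢ j≢c k≢c))) ⟩
      sign j * M zero j * (x * det′ (minor N j) + y * det′ (minor L j))
        ≈⟨ solve 6 (λ s x y m d e → s :* m :* (x :* d :+ y :* e) := x :* (s :* m :* d) :+ y :* (s :* m :* e)) refl
             (sign j) x y (M zero j) (det′ (minor N j)) (det′ (minor L j)) ⟩
      x * (sign j * M zero j * det′ (minor N j)) + y * (sign j * M zero j * det′ (minor L j))
        ≈⟨ +-cong (*-congˡ (*-congʳ (*-congˡ (N-off zero j≢c)))) (*-congˡ (*-congʳ (*-congˡ (L-off zero j≢c)))) ⟩
      x * term N j + y * term L j  ∎

  sum-adjacent : ∀ {n} {a b : Fin n} → Adjacent a b → (f : Fin n → Carrier) →
                 (∀ j → j ≢ a → j ≢ b → f j ≈ 0#) → f a + f b ≈ 0# → sum f ≈ 0#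
  sum-adjacent here f off pair = begin
    f zero + (f (suc zero) + sum rest)  ≈⟨ +-congˡ (+-congˡ (sum-zero λ j → off (suc (suc j)) (λ ()) (λ ()))) ⟩
    f zero + (f (suc zero) + 0#)        ≈⟨ +-congˡ (+-identityʳ _) ⟩
    f zero + f (suc zero)               ≈⟨ pair ⟩
    0#                                  ∎
    where rest = λ j → f (suc (suc j))
  sum-adjacent (there p) f off pair = begin
    f zero + sum (f ∘ suc)  ≈⟨ +-cong (off zero (λ ()) (λ ())) (sum-adjacent p (f ∘ suc)
                                  (λ j j≢a j≢b → off (suc j) (j≢a ∘ Fin.suc-injective) (j≢b ∘ Fin.suc-injective)) pair) ⟩
    0# + 0#                 ≈⟨ +-identityˡ 0# ⟩
    0#                      ∎

  sign-adjacent : ∀ {n} {a b : Fin n} → Adjacent a b → sign b ≈ (- 1#) * sign a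
  sign-adjacent here      = refl
  sign-adjacent (there p) = *-congˡ (sign-adjacent p)

  -- A minor that omits neither column still has two equal adjacent columns and vanishes by
  -- induction. The two remaining terms have equal entries, equal minors and opposite signs.
  det-adjacent : ∀ {n} {a b : Fin n} (M : Mat n) → Adjacent a b →
                 (∀ i → M i a ≈ M i b) → det′ M ≈ 0#
  det-adjacent {suc n} {a} {b} M a⋖b a≈b = sum-adjacent a⋖b term off pair
    where
    term : Fin (suc n) → Carrier
    term j = sign j * M zero j * det′ (minor M j)
    off : ∀ j → j ≢ a → j ≢ b → term j ≈ 0#
    off j j≢a j≢b = trans
      (*-congˡ (det-adjacent (minor M j) (adjacent-punchOut j≢a j≢b a⋖b)
        λ i → ≡.subst₂ (λ a b → M (suc i) a ≈ M (suc i) b)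
          (≡.sym (Fin.punchIn-punchOut j≢a)) (≡.sym (Fin.punchIn-punchOut j≢b)) (a≈b (suc i))))
      (zeroʳ _)
    minors : ∀ i k → minor M b i k ≈ minor M a i k
    minors i k with adjacent-punchIn a⋖b k
    ... | inj₁ eq         = reflexive (≡.cong (M (suc i)) (≡.sym eq))
    ... | inj₂ (eq , eq′) = begin
      M (suc i) (punchIn b k)  ≡⟨ ≡.cong (M (suc i)) eq′ ⟩
      M (suc i) a              ≈⟨ a≈b (suc i) ⟩
      M (suc i) b              ≡⟨ ≡.cong (M (suc i)) eq ⟨
      M (suc i) (punchIn a k)  ∎
    pair : term a + term b ≈ 0#
    pair = begin
      sign a * M zero a * det′ (minor M a) + sign b * M zero b * det′ (minor M b)
        ≈⟨ +-congˡ (*-cong (*-cong (sign-adjacent a⋖b) (sym (a≈b zero))) (det-cong minors)) ⟩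
      sign a * M zero a * det′ (minor M a) + (- 1#) * sign a * M zero a * det′ (minor M a)
        ≈⟨ solve 4 (λ e s m d → s :* m :* d :+ e :* s :* m :* d := s :* m :* d :+ e :* (s :* m :* d)) refl
             (- 1#) (sign a) (M zero a) (det′ (minor M a)) ⟩
      term a + (- 1#) * term a  ≈⟨ +-congˡ (-‿distribˡ-* 1# (term a)) ⟨
      term a + - (1# * term a)  ≈⟨ +-congˡ (-‿cong (*-identityˡ (term a))) ⟩
      term a + - term a         ≈⟨ -‿inverseʳ (term a) ⟩
      0#                        ∎

  infixl 8 _[_≔_]

  _[_≔_] : ∀ {n} → Mat n → Fin n → (Fin n → Carrier) → Mat n
  (M [ c ≔ v ]) i j = if does (j Fin.≟ c) then v i else M i j

  ≔-at : ∀ {n} (M : Mat n) c v i → (M [ c ≔ v ]) i c ≡ v i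
  ≔-at M c v i with c Fin.≟ c
  ... | yes _   = ≡.refl
  ... | no c≢c  = contradiction ≡.refl c≢c

  ≔-off : ∀ {n} (M : Mat n) {c} v i {j} → j ≢ c → (M [ c ≔ v ]) i j ≡ M i j
  ≔-off M {c} v i {j} j≢c with j Fin.≟ c
  ... | yes j≡c = contradiction j≡c j≢c
  ... | no _    = ≡.refl

  ≔-linear : ∀ {n} (M : Mat n) c {u v w : Fin n → Carrier} x y → (∀ i → u i ≈ x * v i + y * w i) →
             det′ (M [ c ≔ u ]) ≈ x * det′ (M [ c ≔ v ]) + y * det′ (M [ c ≔ w ])
  ≔-linear M c {u} {v} {w} x y eq = det-linear c x y
    (λ i → begin
      (M [ c ≔ u ]) i c  ≡⟨ ≔-at M c u i ⟩
      u i                ≈⟨ eq i ⟩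
      x * v i + y * w i  ≡⟨ ≡.cong₂ (λ a b → x * a + y * b) (≔-at M c v i) (≔-at M c w i) ⟨
      x * (M [ c ≔ v ]) i c + y * (M [ c ≔ w ]) i c ∎)
    (λ i j≢c → reflexive (≡.trans (≔-off M u i j≢c) (≡.sym (≔-off M v i j≢c))))
    (λ i j≢c → reflexive (≡.trans (≔-off M u i j≢c) (≡.sym (≔-off M w i j≢c))))

  ≔-self : ∀ {n} (M : Mat n) c → det′ (M [ c ≔ (λ i → M i c) ]) ≈ det′ M
  ≔-self M c = det-cong at
    where
    at : ∀ i j → (M [ c ≔ (λ i → M i c) ]) i j ≈ M i j
    at i j with j Fin.≟ c
    ... | yes ≡.refl = refl
    ... | no _       = refl

  ≔-sum : ∀ {n} (M : Mat n) c {m} (x : Fin m → Carrier) (v : Fin m → Fin n → Carrier) →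
          det′ (M [ c ≔ (λ i → sum λ a → x a * v a i) ]) ≈ sum λ a → x a * det′ (M [ c ≔ v a ])
  ≔-sum M c {zero} x v = begin
    -- The zero column is a combination of itself with both scalars zero, so linearity alone gives
    -- the empty case.
    D                    ≈⟨ ≔-linear M c 0# 0# (λ i → sym (trans (+-cong (zeroˡ 0#) (zeroˡ 0#)) (+-identityˡ 0#))) ⟩
    0# * D + 0# * D      ≈⟨ +-cong (zeroˡ D) (zeroˡ D) ⟩
    0# + 0#              ≈⟨ +-identityˡ 0# ⟩
    0#                   ∎
    where D = det′ (M [ c ≔ (λ _ → 0#) ])
  ≔-sum M c {suc m} x v = begin
    det′ (M [ c ≔ (λ i → x zero * v zero i + tail i) ])
      ≈⟨ ≔-linear M c (x zero) 1# (λ i → +-congˡ (sym (*-identityˡ (tail i)))) ⟩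
    x zero * det′ (M [ c ≔ v zero ]) + 1# * det′ (M [ c ≔ tail ])
      ≈⟨ +-congˡ (trans (*-identityˡ _) (≔-sum M c (x ∘ suc) (v ∘ suc))) ⟩
    x zero * det′ (M [ c ≔ v zero ]) + sum (λ a → x (suc a) * det′ (M [ c ≔ v (suc a) ]))  ∎
    where tail = λ i → sum λ a → x (suc a) * v (suc a) i

  -- An equal pair at distance d + 2 is brought one step closer: with u, w the
  -- adjacent columns c, b and w equal to column a, expanding the vanishing
  -- determinant with columns (u + w, u + w) leaves only the one with (u, w).
  det-distance : ∀ d {n} {a b : Fin n} (M : Mat n) → toℕ b ≡ suc d ℕ.+ toℕ a →
                 (∀ i → M i a ≈ M i b) → det′ M ≈ 0#
  det-distance d {a = a} {suc b} M dist a≈b with ℕ.suc-injective dist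
  det-distance zero {a = a} {suc b} M dist a≈b | eq = det-adjacent M adj a≈b
    where
    adj : Adjacent a (suc b)
    adj = ≡.subst (λ z → Adjacent z (suc b)) (Fin.toℕ-injective (≡.trans (Fin.toℕ-inject₁ b) eq)) (adjacent-inject₁ b)
  det-distance (suc d) {n = suc n} {a} {suc b′} M dist a≈b | eq = begin
    det′ M                          ≈⟨ det-cong (λ i j → sym (K-self i j)) ⟩
    det′ (K u w)                    ≈⟨ trans (+-congʳ (trans (*-identityˡ _) (vanish-cb u))) (trans (+-identityˡ _) (*-identityˡ _)) ⟨
    1# * det′ (K u u) + 1# * det′ (K u w)  ≈⟨ ≔-linear (M [ c ≔ u ]) b 1# 1# plus ⟨
    det′ (K u (u ⊕ w))              ≈⟨ trans (+-congˡ (trans (*-identityˡ _) vanish-ac)) (trans (+-identityʳ _) (*-identityˡ _)) ⟨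
    1# * det′ (K u (u ⊕ w)) + 1# * det′ (K w (u ⊕ w))  ≈⟨ K-linearˡ ⟨
    det′ (K (u ⊕ w) (u ⊕ w))        ≈⟨ vanish-cb (u ⊕ w) ⟩
    0#                              ∎
    where
    b c : Fin (suc n)
    b = suc b′
    c = inject₁ b′
    Col = Fin (suc n) → Carrier
    u w : Col
    u i = M i c
    w i = M i b
    _⊕_ : Col → Col → Col
    (x ⊕ y) i = x i + y i
    plus : ∀ i → (u ⊕ w) i ≈ 1# * u i + 1# * w i
    plus i = sym (+-cong (*-identityˡ _) (*-identityˡ _))
    c⋖b : Adjacent c b
    c⋖b = adjacent-inject₁ b′
    c≢b : c ≢ b
    c≢b = adjacent-≢ c⋖b
    toℕ-c : toℕ c ≡ suc d ℕ.+ toℕ a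
    toℕ-c = ≡.trans (Fin.toℕ-inject₁ b′) eq
    a≢c : a ≢ c
    a≢c a≡c = ℕ.m≢1+n+m (toℕ a) (≡.trans (≡.cong toℕ a≡c) toℕ-c)
    a≢b : a ≢ b
    a≢b a≡b = ℕ.m≢1+n+m (toℕ a) (≡.trans (≡.cong toℕ a≡b) dist)
    K : Col → Col → Mat (suc n)
    K x y = M [ c ≔ x ] [ b ≔ y ]
    K-b : ∀ x y i → K x y i b ≡ y i
    K-b x y i = ≔-at (M [ c ≔ x ]) b y i
    K-c : ∀ x y i → K x y i c ≡ x i
    K-c x y i = ≡.trans (≔-off (M [ c ≔ x ]) y i c≢b) (≔-at M c x i)
    K-off : ∀ x y i {j} → j ≢ c → j ≢ b → K x y i j ≡ M i j
    K-off x y i j≢c j≢b = ≡.trans (≔-off (M [ c ≔ x ]) y i j≢b) (≔-off M x i j≢c)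
    K-self : ∀ i j → K u w i j ≈ M i j
    K-self i j with j Fin.≟ b
    ... | yes ≡.refl = refl
    ... | no _ with j Fin.≟ c
    ...   | yes ≡.refl = refl
    ...   | no _       = refl
    vanish-cb : ∀ x → det′ (K x x) ≈ 0#
    vanish-cb x = det-adjacent (K x x) c⋖b λ i → reflexive (≡.trans (K-c x x i) (≡.sym (K-b x x i)))
    vanish-ac : det′ (K w (u ⊕ w)) ≈ 0#
    vanish-ac = det-distance d (K w (u ⊕ w)) toℕ-c λ i → begin
      K w (u ⊕ w) i a  ≡⟨ K-off w (u ⊕ w) i a≢c a≢b ⟩
      M i a            ≈⟨ a≈b i ⟩
      M i b            ≡⟨ K-c w (u ⊕ w) i ⟨
      K w (u ⊕ w) i c  ∎
    K-same : ∀ x x′ y i {j} → j ≢ c → K x y i j ≈ K x′ y i j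
    K-same x x′ y i {j} j≢c with j Fin.≟ b
    ... | yes _ = refl
    ... | no _  = reflexive (≡.trans (≔-off M x i j≢c) (≡.sym (≔-off M x′ i j≢c)))
    K-linearˡ : det′ (K (u ⊕ w) (u ⊕ w)) ≈ 1# * det′ (K u (u ⊕ w)) + 1# * det′ (K w (u ⊕ w))
    K-linearˡ = det-linear c 1# 1#
      (λ i → begin
        K (u ⊕ w) (u ⊕ w) i c  ≡⟨ K-c (u ⊕ w) (u ⊕ w) i ⟩
        u i + w i              ≈⟨ plus i ⟩
        1# * u i + 1# * w i    ≡⟨ ≡.cong₂ (λ x y → 1# * x + 1# * y) (K-c u (u ⊕ w) i) (K-c w (u ⊕ w) i) ⟨
        1# * K u (u ⊕ w) i c + 1# * K w (u ⊕ w) i c  ∎)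
      (λ i → K-same (u ⊕ w) u (u ⊕ w) i)
      (λ i → K-same (u ⊕ w) w (u ⊕ w) i)

  det-< : ∀ {n} {a b : Fin n} (M : Mat n) → toℕ a ℕ.< toℕ b → (∀ i → M i a ≈ M i b) → det′ M ≈ 0#
  det-< {a = a} M a<b with ℕ.m≤n⇒∃[o]m+o≡n a<b
  ... | d , eq = det-distance d M (≡.trans (≡.sym eq) (≡.cong suc (ℕ.+-comm (toℕ a) d)))

  det-alternating : ∀ {n} {a b : Fin n} (M : Mat n) → a ≢ b → (∀ i → M i a ≈ M i b) → det′ M ≈ 0#
  det-alternating {n} {a} {b} M a≢b a≈b with ℕ.<-cmp (toℕ a) (toℕ b)
  ... | tri< a<b _ _ = det-< M a<b a≈b
  ... | tri≈ _ a≡b _ = contradiction (Fin.toℕ-injective a≡b) a≢b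
  ... | tri> _ _ b<a = det-< M b<a (sym ∘ a≈b)

  -- The replacing column is column `c` of the product of `M` and `N`, a combination of the columns
  -- of `M`. Expanding it, the summand of `a ≢ c` repeats column `a` and vanishes, while that of
  -- `a ≡ c` restores `M` with the factor `N c c`.
  det-trace : ∀ {n} (M : Mat n) (N : Mat n) →
              sum (λ c → det′ (M [ c ≔ (λ i → sum λ a → N a c * M i a) ])) ≈ sum (λ c → N c c) * det′ M
  det-trace M N = begin
    sum (λ c → det′ (M [ c ≔ (λ i → sum λ a → N a c * M i a) ]))  ≈⟨ sum-cong-≋ each ⟩
    sum (λ c → N c c * det′ M)                                    ≈⟨ *-distribʳ-sum (det′ M) (λ c → N c c) ⟨
    sum (λ c → N c c) * det′ M                                    ∎
    where
    each : ∀ c → det′ (M [ c ≔ (λ i → sum λ a → N a c * M i a) ]) ≈ N c c * det′ M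
    each c = begin
      det′ (M [ c ≔ (λ i → sum λ a → N a c * M i a) ])  ≈⟨ ≔-sum M c (λ a → N a c) (λ a i → M i a) ⟩
      sum (λ a → N a c * det′ (M [ c ≔ (λ i → M i a) ]))
        ≈⟨ sum-supported _ c (λ a a≢c → trans (*-congˡ (det-alternating (M [ c ≔ (λ i → M i a) ]) a≢c
             λ i → reflexive (≡.trans (≔-off M (λ i → M i a) i a≢c) (≡.sym (≔-at M c (λ i → M i a) i))))) (zeroʳ _)) ⟩
      N c c * det′ (M [ c ≔ (λ i → M i c) ])            ≈⟨ *-congˡ (≔-self M c) ⟩
      N c c * det′ M                                    ∎

  det-δ : ∀ n → det′ (δ {n}) ≈ 1#
  det-δ zero    = refl
  det-δ (suc n) = begin
    sum term                ≈⟨ sum-supported term zero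
                                 (λ { zero 0≢0 → contradiction ≡.refl 0≢0
                                    ; (suc j) _ → trans (*-congʳ (zeroʳ _)) (zeroˡ _) }) ⟩
    1# * 1# * det′ (δ {n})  ≈⟨ *-cong (*-identityˡ 1#) (det-δ n) ⟩
    1# * 1#                 ≈⟨ *-identityˡ 1# ⟩
    1#                      ∎
    where
    term : Fin (suc n) → Carrier
    term j = sign j * δ zero j * det′ (minor (δ {suc n}) j)

  module Derivation
    (d : Carrier → Carrier)
    (d-cong : ∀ {x y} → x ≈ y → d x ≈ d y)
    (d-+ : ∀ x y → d (x + y) ≈ d x + d y)
    (d-leibniz : ∀ x y → d (x * y) ≈ d x * y + x * d y)
    where

    d-0 : d 0# ≈ 0#
    d-0 = +-identityʳ-unique (d 0#) (d 0#) (trans (sym (d-+ 0# 0#)) (d-cong (+-identityˡ 0#)))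

    d-1 : d 1# ≈ 0#
    d-1 = +-identityʳ-unique (d 1#) (d 1#) (begin
      d 1# + d 1#            ≈⟨ +-cong (*-identityʳ (d 1#)) (*-identityˡ (d 1#)) ⟨
      d 1# * 1# + 1# * d 1#  ≈⟨ d-leibniz 1# 1# ⟨
      d (1# * 1#)            ≈⟨ d-cong (*-identityˡ 1#) ⟩
      d 1#                   ∎)

    d-[-1] : d (- 1#) ≈ 0#
    d-[-1] = begin
      d (- 1#)         ≈⟨ +-identityʳ _ ⟨
      d (- 1#) + 0#    ≈⟨ +-congˡ d-1 ⟨
      d (- 1#) + d 1#  ≈⟨ d-+ (- 1#) 1# ⟨
      d (- 1# + 1#)    ≈⟨ d-cong (-‿inverseˡ 1#) ⟩
      d 0#             ≈⟨ d-0 ⟩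
      0#               ∎

    d-* : ∀ c x → d c ≈ 0# → d (c * x) ≈ c * d x
    d-* c x dc≈0 = begin
      d (c * x)          ≈⟨ d-leibniz c x ⟩
      d c * x + c * d x  ≈⟨ +-congʳ (trans (*-congʳ dc≈0) (zeroˡ x)) ⟩
      0# + c * d x       ≈⟨ +-identityˡ _ ⟩
      c * d x            ∎

    d-sign : ∀ k → d ((- 1#) ^ k) ≈ 0#
    d-sign zero    = d-1
    d-sign (suc k) = trans (d-* (- 1#) _ d-[-1]) (trans (*-congˡ (d-sign k)) (zeroʳ _))

    d-sum : ∀ {n} (f : Fin n → Carrier) → d (sum f) ≈ sum (d ∘ f)
    d-sum {zero}  f = d-0
    d-sum {suc n} f = trans (d-+ _ _) (+-congˡ (d-sum (f ∘ suc)))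

    -- Signs are killed by `d`, so the Leibniz rule splits each Laplace term in two. Differentiating
    -- the entry gives the summand for column `j`; differentiating the minor gives, by induction,
    -- those for the columns `punchIn j c`. Together these are all columns.
    d-det : ∀ {n} (M : Mat n) → d (det′ M) ≈ sum (λ c → det′ (M [ c ≔ (λ i → d (M i c)) ]))
    d-det {zero}  M = d-1
    d-det {suc n} M = begin
      d (sum (term M))                                  ≈⟨ d-sum (term M) ⟩
      sum (λ j → d (term M j))                          ≈⟨ sum-cong-≋ each ⟩
      -- After the exchange, the inner sum for fixed `c` is the Laplace expansion of the matrix with
      -- column `c` differentiated.
      sum (λ j → sum λ c → term (M [ c ≔ dcol c ]) j)   ≈⟨ ∑-comm (λ j c → term (M [ c ≔ dcol c ]) j) ⟩
      sum (λ c → det′ (M [ c ≔ dcol c ]))               ∎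
      where
      dcol : Fin (suc n) → Fin (suc n) → Carrier
      dcol c i = d (M i c)
      term : Mat (suc n) → Fin (suc n) → Carrier
      term K j = sign j * K zero j * det′ (minor K j)
      minor-at : ∀ j i k → minor M j i k ≈ minor (M [ j ≔ dcol j ]) j i k
      minor-at j i k = reflexive (≡.sym (≔-off M (dcol j) (suc i) (Fin.punchInᵢ≢i j k)))
      minor-off : ∀ j c i k → (minor M j [ c ≔ (λ i → d (minor M j i c)) ]) i k
                              ≈ minor (M [ punchIn j c ≔ dcol (punchIn j c) ]) j i k
      minor-off j c i k with k Fin.≟ c
      ... | yes ≡.refl = reflexive (≡.sym (≔-at M (punchIn j k) (dcol (punchIn j k)) (suc i)))
      ... | no k≢c     = reflexive (≡.sym (≔-off M (dcol (punchIn j c)) (suc i) (k≢c ∘ Fin.punchIn-injective j k c)))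
      each : ∀ j → d (term M j) ≈ sum (λ c → term (M [ c ≔ dcol c ]) j)
      each j = begin
        d (sign j * M zero j * D)                  ≈⟨ d-cong (*-assoc _ _ _) ⟩
        d (sign j * (M zero j * D))                ≈⟨ d-* (sign j) _ (d-sign (toℕ j)) ⟩
        sign j * d (M zero j * D)                  ≈⟨ *-congˡ (d-leibniz (M zero j) D) ⟩
        sign j * (d (M zero j) * D + M zero j * d D)
          ≈⟨ solve 5 (λ s x y a b → s :* (x :* a :+ y :* b) := s :* x :* a :+ s :* y :* b) refl
               (sign j) (d (M zero j)) (M zero j) D (d D) ⟩
        sign j * d (M zero j) * D + sign j * M zero j * d D
          ≈⟨ +-cong
               (*-cong (*-congˡ (reflexive (≡.sym (≔-at M j (dcol j) zero)))) (det-cong (minor-at j)))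
               (*-congˡ (d-det (minor M j))) ⟩
        term (M [ j ≔ dcol j ]) j + sign j * M zero j * sum (λ c → det′ (minor M j [ c ≔ (λ i → d (minor M j i c)) ]))
          ≈⟨ +-congˡ (*-distribˡ-sum {n} (sign j * M zero j) _) ⟩
        term (M [ j ≔ dcol j ]) j + sum (λ c → sign j * M zero j * det′ (minor M j [ c ≔ (λ i → d (minor M j i c)) ]))
          ≈⟨ +-congˡ (sum-cong-≋ λ c → *-cong
               (*-congˡ (reflexive (≡.sym (≔-off M (dcol (punchIn j c)) zero (Fin.punchInᵢ≢i j c ∘ ≡.sym)))))
               (det-cong (minor-off j c))) ⟩
        term (M [ j ≔ dcol j ]) j + sum (λ c → term (M [ punchIn j c ≔ dcol (punchIn j c) ]) j)
          ≈⟨ sum-remove (λ c → term (M [ c ≔ dcol c ]) j) ⟨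
        sum (λ c → term (M [ c ≔ dcol c ]) j)  ∎
        where D = det′ (minor M j)

    -- Jacobi's formula with the adjugate replaced by an inverse N of M up to the scalar p.
    d-det-scalar : ∀ {n} (M N : Mat n) p u → (∀ i c → d (M i c) ≈ u * δ i c) →
                   (∀ i c → sum (λ a → N a c * M i a) ≈ p * δ i c) →
                   p * d (det′ M) ≈ u * (sum (λ c → N c c) * det′ M)
    d-det-scalar {n} M N p u dM≈ MN≈ = begin
      p * d (det′ M)  ≈⟨ *-congˡ (d-det M) ⟩
      p * sum (λ c → det′ (M [ c ≔ (λ i → d (M i c)) ]))  ≈⟨ *-distribˡ-sum {n} p _ ⟩
      sum (λ c → p * det′ (M [ c ≔ (λ i → d (M i c)) ]))  ≈⟨ sum-cong-≋ each ⟩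
      sum (λ c → u * det′ (M [ c ≔ (λ i → sum λ a → N a c * M i a) ]))  ≈⟨ *-distribˡ-sum {n} u _ ⟨
      u * sum (λ c → det′ (M [ c ≔ (λ i → sum λ a → N a c * M i a) ]))  ≈⟨ *-congˡ (det-trace M N) ⟩
      u * (sum (λ c → N c c) * det′ M)  ∎
      where
      scale : ∀ c x {v w : Fin _ → Carrier} → (∀ i → v i ≈ x * w i) → det′ (M [ c ≔ v ]) ≈ x * det′ (M [ c ≔ w ])
      scale c x {v} {w} eq = begin
        det′ (M [ c ≔ v ])  ≈⟨ ≔-linear M c x 0# (λ i → trans (eq i) (sym (trans (+-congˡ (zeroˡ (w i))) (+-identityʳ _)))) ⟩
        x * det′ (M [ c ≔ w ]) + 0# * det′ (M [ c ≔ w ])  ≈⟨ trans (+-congˡ (zeroˡ _)) (+-identityʳ _) ⟩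
        x * det′ (M [ c ≔ w ])  ∎
      each : ∀ c → p * det′ (M [ c ≔ (λ i → d (M i c)) ]) ≈ u * det′ (M [ c ≔ (λ i → sum λ a → N a c * M i a) ])
      each c = begin
        p * det′ (M [ c ≔ (λ i → d (M i c)) ])         ≈⟨ *-congˡ (scale c u (λ i → dM≈ i c)) ⟩
        p * (u * det′ (M [ c ≔ (λ i → δ i c) ]))       ≈⟨ solve 3 (λ p u x → p :* (u :* x) := u :* (p :* x)) refl p u _ ⟩
        u * (p * det′ (M [ c ≔ (λ i → δ i c) ]))       ≈⟨ *-congˡ (scale c p (λ i → MN≈ i c)) ⟨
        u * det′ (M [ c ≔ (λ i → sum λ a → N a c * M i a) ])  ∎

-- Convolution of coefficient sequences

module Convolution {r ℓ} (R : CommutativeRing r ℓ) where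

  open CommutativeRing R hiding (zero)
  open Algebra.Definitions.RawMonoid +-rawMonoid using () renaming (_×_ to _·_)
  open import Algebra.Solver.Ring.NaturalCoefficients.Default commutativeSemiring
    using (solve; _:=_; _:+_; _:*_)
  open import Relation.Binary.Reasoning.Setoid setoid

  private
    Seq = ℕ → Carrier

  infixl 7 _⋆_

  -- The Cauchy product, recursing on the first factor as `_*ᴾ_` does. The multiplicative laws of
  -- polynomials are proved for sequences, where lists that differ by trailing zeros coincide.
  _⋆_ : Seq → Seq → Seq
  (f ⋆ g) zero    = f 0 * g 0
  (f ⋆ g) (suc i) = f 0 * g (suc i) + (f ∘ suc ⋆ g) i

  ⋆-cong : ∀ {f f′ g g′} → (∀ i → f i ≈ f′ i) → (∀ i → g i ≈ g′ i) → ∀ i → (f ⋆ g) i ≈ (f′ ⋆ g′) i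
  ⋆-cong f≈ g≈ zero    = *-cong (f≈ 0) (g≈ 0)
  ⋆-cong f≈ g≈ (suc i) = +-cong (*-cong (f≈ 0) (g≈ (suc i))) (⋆-cong (f≈ ∘ suc) g≈ i)

  -- The definition peels only the first factor; this mirror image is what commutativity needs.
  ⋆-sucʳ : ∀ f g i → (f ⋆ g) (suc i) ≈ (f ⋆ g ∘ suc) i + f (suc i) * g 0
  ⋆-sucʳ f g zero    = refl
  ⋆-sucʳ f g (suc i) = trans (+-congˡ (⋆-sucʳ (f ∘ suc) g i)) (sym (+-assoc _ _ _))

  ⋆-comm : ∀ f g i → (f ⋆ g) i ≈ (g ⋆ f) i
  ⋆-comm f g zero    = *-comm (f 0) (g 0)
  ⋆-comm f g (suc i) = begin
    f 0 * g (suc i) + (f ∘ suc ⋆ g) i  ≈⟨ +-cong (*-comm _ _) (⋆-comm (f ∘ suc) g i) ⟩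
    g (suc i) * f 0 + (g ⋆ f ∘ suc) i  ≈⟨ +-comm _ _ ⟩
    (g ⋆ f ∘ suc) i + g (suc i) * f 0  ≈⟨ ⋆-sucʳ g f i ⟨
    (g ⋆ f) (suc i)                    ∎

  ⋆-zeroˡ : ∀ {f} g → (∀ i → f i ≈ 0#) → ∀ i → (f ⋆ g) i ≈ 0#
  ⋆-zeroˡ g f≈0 zero    = trans (*-congʳ (f≈0 0)) (zeroˡ _)
  ⋆-zeroˡ g f≈0 (suc i) = trans
    (+-cong (trans (*-congʳ (f≈0 0)) (zeroˡ _)) (⋆-zeroˡ g (f≈0 ∘ suc) i)) (+-identityˡ 0#)

  ⋆-constˡ : ∀ {f} g → (∀ i → f (suc i) ≈ 0#) → ∀ i → (f ⋆ g) i ≈ f 0 * g i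
  ⋆-constˡ g f≈0 zero    = refl
  ⋆-constˡ g f≈0 (suc i) = trans (+-congˡ (⋆-zeroˡ g f≈0 i)) (+-identityʳ _)

  ⋆-distribʳ : ∀ h f g i → ((λ j → f j + g j) ⋆ h) i ≈ (f ⋆ h) i + (g ⋆ h) i
  ⋆-distribʳ h f g zero    = distribʳ (h 0) (f 0) (g 0)
  ⋆-distribʳ h f g (suc i) = begin
    (f 0 + g 0) * h (suc i) + ((λ j → f (suc j) + g (suc j)) ⋆ h) i  ≈⟨ +-congˡ (⋆-distribʳ h (f ∘ suc) (g ∘ suc) i) ⟩
    (f 0 + g 0) * h (suc i) + ((f ∘ suc ⋆ h) i + (g ∘ suc ⋆ h) i)
      ≈⟨ solve 5 (λ a b c x y → (a :+ b) :* c :+ (x :+ y) := (a :* c :+ x) :+ (b :* c :+ y)) refl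
           (f 0) (g 0) (h (suc i)) ((f ∘ suc ⋆ h) i) ((g ∘ suc ⋆ h) i) ⟩
    (f ⋆ h) (suc i) + (g ⋆ h) (suc i)                                ∎

  ⋆-scaleˡ : ∀ a f g i → ((λ j → a * f j) ⋆ g) i ≈ a * (f ⋆ g) i
  ⋆-scaleˡ a f g zero    = *-assoc a (f 0) (g 0)
  ⋆-scaleˡ a f g (suc i) = begin
    a * f 0 * g (suc i) + ((λ j → a * f (suc j)) ⋆ g) i  ≈⟨ +-cong (*-assoc _ _ _) (⋆-scaleˡ a (f ∘ suc) g i) ⟩
    a * (f 0 * g (suc i)) + a * (f ∘ suc ⋆ g) i          ≈⟨ distribˡ a _ _ ⟨
    a * (f ⋆ g) (suc i)                                  ∎

  ⋆-assoc : ∀ f g h i → ((f ⋆ g) ⋆ h) i ≈ (f ⋆ (g ⋆ h)) i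
  ⋆-assoc f g h zero    = *-assoc (f 0) (g 0) (h 0)
  ⋆-assoc f g h (suc i) = begin
    f 0 * g 0 * h (suc i) + ((λ j → f 0 * g (suc j) + (f ∘ suc ⋆ g) j) ⋆ h) i
      ≈⟨ +-congˡ (⋆-distribʳ h (λ j → f 0 * g (suc j)) (f ∘ suc ⋆ g) i) ⟩
    f 0 * g 0 * h (suc i) + (((λ j → f 0 * g (suc j)) ⋆ h) i + ((f ∘ suc ⋆ g) ⋆ h) i)
      ≈⟨ +-congˡ (+-cong (⋆-scaleˡ (f 0) (g ∘ suc) h i) (⋆-assoc (f ∘ suc) g h i)) ⟩
    f 0 * g 0 * h (suc i) + (f 0 * (g ∘ suc ⋆ h) i + (f ∘ suc ⋆ (g ⋆ h)) i)
      ≈⟨ solve 5 (λ a b c x y → a :* b :* c :+ (a :* x :+ y) := a :* (b :* c :+ x) :+ y) refl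
           (f 0) (g 0) (h (suc i)) ((g ∘ suc ⋆ h) i) ((f ∘ suc ⋆ (g ⋆ h)) i) ⟩
    f 0 * (g ⋆ h) (suc i) + (f ∘ suc ⋆ (g ⋆ h)) i  ∎

  ·-assoc : ∀ i x y → i · (x * y) ≈ x * (i · y)
  ·-assoc zero    x y = sym (zeroʳ x)
  ·-assoc (suc i) x y = trans (+-congˡ (·-assoc i x y)) (sym (distribˡ x y _))

  ·-distrib : ∀ i x y → i · (x + y) ≈ i · x + i · y
  ·-distrib zero    x y = sym (+-identityˡ 0#)
  ·-distrib (suc i) x y = trans (+-congˡ (·-distrib i x y))
    (solve 4 (λ x y a b → x :+ y :+ (a :+ b) := x :+ a :+ (y :+ b)) refl x y (i · x) (i · y))

  -- The summand with indices j and i - j has weight i = j + (i - j), and each part of the weight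
  -- goes to one factor. This is the Leibniz rule for x d/dx.
  ⋆-leibniz : ∀ f g i → i · (f ⋆ g) i ≈ ((λ j → j · f j) ⋆ g) i + (f ⋆ (λ j → j · g j)) i
  ⋆-leibniz f g zero    = sym (trans (+-cong (zeroˡ (g 0)) (zeroʳ (f 0))) (+-identityˡ 0#))
  ⋆-leibniz f g (suc i) = begin
    suc i · (f 0 * g (suc i) + F)
      ≈⟨ ·-distrib (suc i) (f 0 * g (suc i)) F ⟩
    suc i · (f 0 * g (suc i)) + (F + i · F)
      ≈⟨ +-cong (·-assoc (suc i) (f 0) (g (suc i))) (+-congˡ (⋆-leibniz (f ∘ suc) g i)) ⟩
    f 0 * (suc i · g (suc i)) + (F + (A + B))
      ≈⟨ solve 4 (λ x f a b → x :+ (f :+ (a :+ b)) := (f :+ a) :+ (x :+ b)) refl (f 0 * (suc i · g (suc i))) F A B ⟩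
    (F + A) + (f ⋆ (λ j → j · g j)) (suc i)
      ≈⟨ +-congʳ (trans (+-congʳ (zeroˡ (g (suc i)))) (trans (+-identityˡ _) (⋆-distribʳ g (f ∘ suc) (λ j → j · f (suc j)) i))) ⟨
    ((λ j → j · f j) ⋆ g) (suc i) + (f ⋆ (λ j → j · g j)) (suc i)  ∎
    where
    F = (f ∘ suc ⋆ g) i
    A = ((λ j → j · f (suc j)) ⋆ g) i
    B = (f ∘ suc ⋆ (λ j → j · g j)) i

  -- The value `a` may be zero, so `d` is only an upper bound for the degree. Products and sums then
  -- need no nonvanishing condition, and off-diagonal entries can be given the same bound as
  -- diagonal ones.
  Leads : (ℕ → Carrier) → ℕ → Carrier → Set ℓ
  Leads f d a = f d ≈ a × (∀ i → d ℕ.< i → f i ≈ 0#)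

  ⋆-leads : ∀ {f g d e a b} → Leads f d a → Leads g e b → Leads (f ⋆ g) (d ℕ.+ e) (a * b)
  ⋆-leads {f} {g} {zero} {e} (fd , f>) (ge , g>) =
      trans (⋆-constˡ g f0 e) (*-cong fd ge)
    , λ i e<i → trans (⋆-constˡ g f0 i) (trans (*-congˡ (g> i e<i)) (zeroʳ _))
    where f0 = λ i → f> (suc i) (s≤s z≤n)
  ⋆-leads {f} {g} {suc d} {e} (fd , f>) (ge , g>) = top , above
    where
    IH = ⋆-leads {f ∘ suc} {g} {d} {e} (fd , λ i d<i → f> (suc i) (s≤s d<i)) (ge , g>)
    skip : ∀ i → d ℕ.+ e ℕ.≤ i → (f ⋆ g) (suc i) ≈ (f ∘ suc ⋆ g) i
    skip i d+e≤i = trans (+-congʳ (trans (*-congˡ (g> (suc i) (s≤s (ℕ.m+n≤o⇒n≤o d d+e≤i)))) (zeroʳ _))) (+-identityˡ _)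
    top = trans (skip (d ℕ.+ e) ℕ.≤-refl) (proj₁ IH)
    above : ∀ i → suc d ℕ.+ e ℕ.< i → (f ⋆ g) i ≈ 0#
    above (suc i) (s≤s d+e<i) = trans (skip i (ℕ.<⇒≤ d+e<i)) (proj₂ IH i d+e<i)

-- The differential equation under multiplication by x

module EulerOperator {r ℓ} (R : CommutativeRing r ℓ) where
  open CommutativeRing R hiding (zero)
  open Algebra.Definitions.RawMonoid +-rawMonoid using () renaming (_×_ to _·_)
  open Convolution R using (·-assoc)
  open Algebra.Properties.Monoid.Mult +-monoid using (×-congʳ)
  open import Algebra.Solver.Ring.NaturalCoefficients.Default commutativeSemiring
    using (solve; _:=_; _:+_; _:*_)
  open import Relation.Binary.Reasoning.Setoid setoid

  -- The equation p θf = r p f + x u f passes to x f, for which θ(x f) = x (f + θf).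
  multiply-by-x : ∀ {x p u f θf} r → p * θf ≈ r · (p * f) + x * (u * f) →
                  p * (x * (f + θf)) ≈ suc r · (p * (x * f)) + x * (u * (x * f))
  multiply-by-x {x} {p} {u} {f} {θf} r eq = begin
    p * (x * (f + θf))
      ≈⟨ solve 4 (λ p x f g → p :* (x :* (f :+ g)) := x :* (p :* f :+ p :* g)) refl p x f θf ⟩
    x * (p * f + p * θf)
      ≈⟨ *-congˡ (+-congˡ eq) ⟩
    x * (p * f + (r · (p * f) + x * (u * f)))
      ≈⟨ solve 5 (λ x p f e u → x :* (p :* f :+ (e :+ x :* (u :* f))) := (p :* (x :* f) :+ x :* e) :+ x :* (u :* (x :* f))) refl
           x p f (r · (p * f)) u ⟩
    (p * (x * f) + x * r · (p * f)) + x * (u * (x * f))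
      ≈⟨ +-congʳ (+-congˡ (trans (sym (·-assoc r x (p * f)))
           (×-congʳ r (solve 3 (λ x p f → x :* (p :* f) := p :* (x :* f)) refl x p f)))) ⟩
    suc r · (p * (x * f)) + x * (u * (x * f))  ∎

-- The matrix inverse to x I - A up to a scalar

module StronglyRegularMatrix {r ℓ} (R : CommutativeRing r ℓ) where

  open CommutativeRing R hiding (zero)
  open FiniteSums R
  open Algebra.Properties.Ring ring using (+-cancelʳ)
  open Algebra.Definitions.RawMonoid +-rawMonoid using () renaming (_×_ to _·_)
  open import Algebra.Solver.Ring.NaturalCoefficients.Default commutativeSemiring
    using (solve; _:=_; _:+_; _:*_)
  open import Relation.Binary.Reasoning.Setoid setoid

  -- The parameters satisfy A² = t I + s A + m J and A J = k J, the matrix M is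
  -- x I − A, and y = x − k, z = x − s, p = y (x z − t).
  module Multiplier {n} (A M : Matrix Carrier n) (x y z k s t m p : Carrier)
    (x≈y+k : x ≈ y + k) (x≈z+s : x ≈ z + s) (p-eq : p + y * t ≈ x * y * z)
    (row : ∀ i → sum (A i) ≈ k)
    (square : ∀ i c → sum (λ a → A i a * A a c) ≈ t * δ i c + s * A i c + m)
    (M+A : ∀ i a → M i a + A i a ≈ x * δ i a)
    where

    N : Matrix Carrier n
    N a c = y * z * δ a c + y * A a c + m

    -- `M` is known only through `M + A`, so the same sum with `A` is added to both sides and
    -- cancelled at the end. All hypotheses are stated without subtraction, which lets a solver for
    -- commutative semirings do the algebra.
    N-multiplies : ∀ i c → sum (λ a → N a c * M i a) ≈ p * δ i c
    N-multiplies i c = +-cancelʳ (sum λ a → N a c * A i a) _ _ (begin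
      sum (λ a → N a c * M i a) + sum (λ a → N a c * A i a)
        ≈⟨ ∑-distrib-+ (λ a → N a c * M i a) (λ a → N a c * A i a) ⟨
      sum (λ a → N a c * M i a + N a c * A i a)
        ≈⟨ sum-cong-≋ (λ a → trans (sym (distribˡ (N a c) (M i a) (A i a))) (trans (*-congˡ (M+A i a))
             (solve 3 (λ n x d → n :* (x :* d) := (n :* x) :* d) refl (N a c) x (δ i a)))) ⟩
      sum (λ a → N a c * x * δ i a)
        ≈⟨ sum-δ (λ a → N a c * x) i ⟩
      (y * z * δ i c + y * A i c + m) * x
        ≈⟨ solve 6 (λ x y z m d a → (y :* z :* d :+ y :* a :+ m) :* x := x :* y :* z :* d :+ y :* a :* x :+ m :* x) refl
             x y z m (δ i c) (A i c) ⟩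
      x * y * z * δ i c + y * A i c * x + m * x
        -- Each occurrence of `x` is rewritten to suit its neighbour: through `p` beside `δ`, as
        -- `z + s` beside `A`, as `y + k` beside `m`. This exposes the right-hand sides of `square`
        -- and `row`.
        ≈⟨ +-cong (+-cong (*-congʳ (sym p-eq)) (*-congˡ x≈z+s)) (*-congˡ x≈y+k) ⟩
      (p + y * t) * δ i c + y * A i c * (z + s) + m * (y + k)
        ≈⟨ solve 9 (λ p y t d a z s m k → (p :+ y :* t) :* d :+ y :* a :* (z :+ s) :+ m :* (y :+ k)
                     := p :* d :+ (y :* z :* a :+ y :* (t :* d :+ s :* a :+ m) :+ m :* k)) refl
             p y t (δ i c) (A i c) z s m k ⟩
      p * δ i c + (y * z * A i c + y * (t * δ i c + s * A i c + m) + m * k)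
        ≈⟨ +-congˡ NA ⟨
      p * δ i c + sum (λ a → N a c * A i a)  ∎)
      where
      f₁ f₂ f₃ : Fin n → Carrier
      f₁ a = y * z * (A i a * δ c a)
      f₂ a = y * (A i a * A a c)
      f₃ a = m * A i a
      δ-sym : ∀ a → δ a c ≈ δ c a
      δ-sym a with a Fin.≟ c | c Fin.≟ a
      ... | yes _   | yes _   = refl
      ... | no _    | no _    = refl
      ... | yes a≡c | no c≢a  = contradiction (≡.sym a≡c) c≢a
      ... | no a≢c  | yes c≡a = contradiction (≡.sym c≡a) a≢c
      NA : sum (λ a → N a c * A i a) ≈ y * z * A i c + y * (t * δ i c + s * A i c + m) + m * k
      NA = begin
        sum (λ a → N a c * A i a)
          ≈⟨ sum-cong-≋ (λ a → trans (*-congʳ (+-congʳ (+-congʳ (*-congˡ (δ-sym a)))))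
               (solve 6 (λ y z d b m a → (y :* z :* d :+ y :* b :+ m) :* a := y :* z :* (a :* d) :+ y :* (a :* b) :+ m :* a) refl
                  y z (δ c a) (A a c) m (A i a))) ⟩
        sum (λ a → f₁ a + f₂ a + f₃ a)  ≈⟨ ∑-distrib-+ (λ a → f₁ a + f₂ a) f₃ ⟩
        sum (λ a → f₁ a + f₂ a) + sum f₃ ≈⟨ +-congʳ (∑-distrib-+ f₁ f₂) ⟩
        sum f₁ + sum f₂ + sum f₃
          ≈⟨ +-cong (+-cong (*-distribˡ-sum {n} (y * z) _) (*-distribˡ-sum {n} y _)) (*-distribˡ-sum {n} m _) ⟨
        y * z * sum (λ a → A i a * δ c a) + y * sum (λ a → A i a * A a c) + m * sum (A i)
          ≈⟨ +-cong (+-cong (*-congˡ (sum-δ (A i) c)) (*-congˡ (square i c))) (*-congˡ (row i)) ⟩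
        y * z * A i c + y * (t * δ i c + s * A i c + m) + m * k  ∎

    N-trace : (∀ i → A i i ≈ 0#) → sum (λ c → N c c) ≈ n · (y * z + m)
    N-trace diagonal = trans (sum-cong-≋ entry) (sum-replicate n)
      where
      entry : ∀ c → N c c ≈ y * z + m
      entry c = begin
        y * z * δ c c + y * A c c + m  ≈⟨ +-congʳ (+-cong (*-congˡ (reflexive (δ-refl c))) (*-congˡ (diagonal c))) ⟩
        y * z * 1# + y * 0# + m        ≈⟨ +-congʳ (+-cong (*-identityʳ (y * z)) (zeroʳ y)) ⟩
        y * z + 0# + m                 ≈⟨ +-congʳ (+-identityʳ (y * z)) ⟩
        y * z + m                      ∎

-- The ring of polynomials

module ℚ-ring = CommutativeRing ℚ.+-*-commutativeRing
open Convolution ℚ.+-*-commutativeRing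
open Algebra.Definitions.RawMonoid ℚ-ring.+-rawMonoid using () renaming (_×_ to _·_)

coeff-+ : ∀ p q i → coeff (p +ᴾ q) i ≡ coeff p i ℚ.+ coeff q i
coeff-+ []      q       i       = ≡.sym (ℚ.+-identityˡ (coeff q i))
coeff-+ (a ∷ p) []      i       = ≡.sym (ℚ.+-identityʳ (coeff (a ∷ p) i))
coeff-+ (a ∷ p) (b ∷ q) zero    = ≡.refl
coeff-+ (a ∷ p) (b ∷ q) (suc i) = coeff-+ p q i

coeff-scale : ∀ a p i → coeff (map (a ℚ.*_) p) i ≡ a ℚ.* coeff p i
coeff-scale a []      i       = ≡.sym (ℚ.*-zeroʳ a)
coeff-scale a (b ∷ p) zero    = ≡.refl
coeff-scale a (b ∷ p) (suc i) = coeff-scale a p i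

coeff-neg : ∀ p i → coeff (-ᴾ p) i ≡ ℚ.- coeff p i
coeff-neg []      i       = ≡.refl
coeff-neg (a ∷ p) zero    = ≡.refl
coeff-neg (a ∷ p) (suc i) = coeff-neg p i

coeff-∷* : ∀ a p q i → coeff ((a ∷ p) *ᴾ q) i ≡ a ℚ.* coeff q i ℚ.+ coeff (0ℚ ∷ (p *ᴾ q)) i
coeff-∷* a p q i = ≡.trans (coeff-+ (map (a ℚ.*_) q) _ i) (≡.cong (ℚ._+ _) (coeff-scale a q i))

coeff-* : ∀ p q i → coeff (p *ᴾ q) i ≡ (coeff p ⋆ coeff q) i
coeff-* []      q i       = ≡.sym (⋆-zeroˡ (coeff q) (λ _ → ≡.refl) i)
coeff-* (a ∷ p) q zero    = ≡.trans (coeff-∷* a p q 0) (ℚ.+-identityʳ _)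
coeff-* (a ∷ p) q (suc i) = ≡.trans (coeff-∷* a p q (suc i)) (≡.cong (a ℚ.* coeff q (suc i) ℚ.+_) (coeff-* p q i))

coeff-constant : ∀ a p i → coeff (constant a *ᴾ p) i ≡ a ℚ.* coeff p i
coeff-constant a p i = ≡.trans (coeff-* (constant a) p i) (⋆-constˡ (coeff p) (λ _ → ≡.refl) i)

-- Since _≈ᴾ_ is a function type, the polynomials it relates cannot be inferred
-- from it; those of the record type can.
infix 4 _≋_

record _≋_ (p q : Polynomial) : Set where
  constructor ⟪_⟫
  field
    at : p ≈ᴾ q

open _≋_

polynomialRing : CommutativeRing 0ℓ 0ℓ
polynomialRing = record
  { Carrier = Polynomial
  ; _≈_ = _≋_
  ; _+_ = _+ᴾ_
  ; _*_ = _*ᴾ_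
  ; -_  = -ᴾ_
  ; 0#  = []
  ; 1#  = constant 1ℚ
  ; isCommutativeRing = record
    { isRing = record
      { +-isAbelianGroup = record
        { isGroup = record
          { isMonoid = record
            { isSemigroup = record
              { isMagma = record
                { isEquivalence = record
                  { refl  = ⟪ (λ _ → ≡.refl) ⟫
                  ; sym   = λ e → ⟪ (λ i → ≡.sym (at e i)) ⟫
                  ; trans = λ e f → ⟪ (λ i → ≡.trans (at e i) (at f i)) ⟫
                  }
                ; ∙-cong = λ {p} {q} {r} {s} e f → ⟪ (λ i → begin
                    coeff (p +ᴾ r) i             ≡⟨ coeff-+ p r i ⟩
                    coeff p i ℚ.+ coeff r i      ≡⟨ ≡.cong₂ ℚ._+_ (at e i) (at f i) ⟩
                    coeff q i ℚ.+ coeff s i      ≡⟨ coeff-+ q s i ⟨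
                    coeff (q +ᴾ s) i             ∎) ⟫
                }
              ; assoc = λ p q r → ⟪ +ᴾ-assoc p q r ⟫
              }
            ; identity = (λ _ → ⟪ (λ _ → ≡.refl) ⟫)
                       , λ p → ⟪ (λ i → ≡.trans (coeff-+ p [] i) (ℚ.+-identityʳ (coeff p i))) ⟫
            }
          ; inverse = (λ p → ⟪ (λ i → begin
                coeff ((-ᴾ p) +ᴾ p) i                ≡⟨ coeff-+ (-ᴾ p) p i ⟩
                coeff (-ᴾ p) i ℚ.+ coeff p i         ≡⟨ ≡.cong (ℚ._+ coeff p i) (coeff-neg p i) ⟩
                ℚ.- coeff p i ℚ.+ coeff p i          ≡⟨ ℚ.+-inverseˡ (coeff p i) ⟩
                0ℚ                                   ∎) ⟫)
            , λ p → ⟪ (λ i → begin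
                coeff (p +ᴾ (-ᴾ p)) i                ≡⟨ coeff-+ p (-ᴾ p) i ⟩
                coeff p i ℚ.+ coeff (-ᴾ p) i         ≡⟨ ≡.cong (coeff p i ℚ.+_) (coeff-neg p i) ⟩
                coeff p i ℚ.+ (ℚ.- coeff p i)        ≡⟨ ℚ.+-inverseʳ (coeff p i) ⟩
                0ℚ                                   ∎) ⟫
          ; ⁻¹-cong = λ {p} {q} e → ⟪ (λ i →
              ≡.trans (coeff-neg p i) (≡.trans (≡.cong ℚ.-_ (at e i)) (≡.sym (coeff-neg q i)))) ⟫
          }
        ; comm = λ p q → ⟪ (λ i →
            ≡.trans (coeff-+ p q i) (≡.trans (ℚ.+-comm (coeff p i) (coeff q i)) (≡.sym (coeff-+ q p i)))) ⟫
        }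
      ; *-cong = λ {p} {q} {r} {s} e f → ⟪ (λ i →
          ≡.trans (coeff-* p r i) (≡.trans (⋆-cong (at e) (at f) i) (≡.sym (coeff-* q s i)))) ⟫
      ; *-assoc = λ p q r → ⟪ *ᴾ-assoc p q r ⟫
      ; *-identity = (λ p → ⟪ *ᴾ-identityˡ p ⟫)
                   , λ p → ⟪ (λ i → ≡.trans (*ᴾ-comm p (constant 1ℚ) i) (*ᴾ-identityˡ p i)) ⟫
      ; distrib = (λ p q r → ⟪ (λ i → begin
            coeff (p *ᴾ (q +ᴾ r)) i              ≡⟨ *ᴾ-comm p (q +ᴾ r) i ⟩
            coeff ((q +ᴾ r) *ᴾ p) i              ≡⟨ *ᴾ-distribʳ p q r i ⟩
            coeff (q *ᴾ p +ᴾ r *ᴾ p) i           ≡⟨ coeff-+ (q *ᴾ p) (r *ᴾ p) i ⟩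
            coeff (q *ᴾ p) i ℚ.+ coeff (r *ᴾ p) i  ≡⟨ ≡.cong₂ ℚ._+_ (*ᴾ-comm q p i) (*ᴾ-comm r p i) ⟩
            coeff (p *ᴾ q) i ℚ.+ coeff (p *ᴾ r) i  ≡⟨ coeff-+ (p *ᴾ q) (p *ᴾ r) i ⟨
            coeff (p *ᴾ q +ᴾ p *ᴾ r) i           ∎) ⟫)
        , λ p q r → ⟪ *ᴾ-distribʳ p q r ⟫
      }
    ; *-comm = λ p q → ⟪ *ᴾ-comm p q ⟫
    }
  }
  where
  open ≡-Reasoning
  +ᴾ-assoc : ∀ p q r → (p +ᴾ q) +ᴾ r ≈ᴾ p +ᴾ (q +ᴾ r)
  +ᴾ-assoc p q r i = begin
    coeff ((p +ᴾ q) +ᴾ r) i                      ≡⟨ coeff-+ (p +ᴾ q) r i ⟩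
    coeff (p +ᴾ q) i ℚ.+ coeff r i               ≡⟨ ≡.cong (ℚ._+ coeff r i) (coeff-+ p q i) ⟩
    coeff p i ℚ.+ coeff q i ℚ.+ coeff r i        ≡⟨ ℚ.+-assoc (coeff p i) (coeff q i) (coeff r i) ⟩
    coeff p i ℚ.+ (coeff q i ℚ.+ coeff r i)      ≡⟨ ≡.cong (coeff p i ℚ.+_) (coeff-+ q r i) ⟨
    coeff p i ℚ.+ coeff (q +ᴾ r) i               ≡⟨ coeff-+ p (q +ᴾ r) i ⟨
    coeff (p +ᴾ (q +ᴾ r)) i                      ∎
  *ᴾ-comm : ∀ p q → p *ᴾ q ≈ᴾ q *ᴾ p
  *ᴾ-comm p q i = ≡.trans (coeff-* p q i) (≡.trans (⋆-comm (coeff p) (coeff q) i) (≡.sym (coeff-* q p i)))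
  *ᴾ-assoc : ∀ p q r → (p *ᴾ q) *ᴾ r ≈ᴾ p *ᴾ (q *ᴾ r)
  *ᴾ-assoc p q r i = begin
    coeff ((p *ᴾ q) *ᴾ r) i                      ≡⟨ coeff-* (p *ᴾ q) r i ⟩
    (coeff (p *ᴾ q) ⋆ coeff r) i                 ≡⟨ ⋆-cong {g = coeff r} (coeff-* p q) (λ _ → ≡.refl) i ⟩
    ((coeff p ⋆ coeff q) ⋆ coeff r) i            ≡⟨ ⋆-assoc (coeff p) (coeff q) (coeff r) i ⟩
    (coeff p ⋆ (coeff q ⋆ coeff r)) i            ≡⟨ ⋆-cong {f = coeff p} (λ _ → ≡.refl) (coeff-* q r) i ⟨
    (coeff p ⋆ coeff (q *ᴾ r)) i                 ≡⟨ coeff-* p (q *ᴾ r) i ⟨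
    coeff (p *ᴾ (q *ᴾ r)) i                      ∎
  *ᴾ-identityˡ : ∀ p → constant 1ℚ *ᴾ p ≈ᴾ p
  *ᴾ-identityˡ p i = ≡.trans (coeff-constant 1ℚ p i) (ℚ.*-identityˡ (coeff p i))
  *ᴾ-distribʳ : ∀ p q r → (q +ᴾ r) *ᴾ p ≈ᴾ q *ᴾ p +ᴾ r *ᴾ p
  *ᴾ-distribʳ p q r i = begin
    coeff ((q +ᴾ r) *ᴾ p) i                         ≡⟨ coeff-* (q +ᴾ r) p i ⟩
    (coeff (q +ᴾ r) ⋆ coeff p) i                    ≡⟨ ⋆-cong {g = coeff p} (coeff-+ q r) (λ _ → ≡.refl) i ⟩
    ((λ j → coeff q j ℚ.+ coeff r j) ⋆ coeff p) i   ≡⟨ ⋆-distribʳ (coeff p) (coeff q) (coeff r) i ⟩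
    (coeff q ⋆ coeff p) i ℚ.+ (coeff r ⋆ coeff p) i ≡⟨ ≡.cong₂ ℚ._+_ (coeff-* q p i) (coeff-* r p i) ⟨
    coeff (q *ᴾ p) i ℚ.+ coeff (r *ᴾ p) i           ≡⟨ coeff-+ (q *ᴾ p) (r *ᴾ p) i ⟨
    coeff (q *ᴾ p +ᴾ r *ᴾ p) i                      ∎

-- The Euler operator x d/dx.
θ : Polynomial → Polynomial
θ []      = []
θ (a ∷ p) = 0ℚ ∷ (p +ᴾ θ p)

·-zero : ∀ i → i · 0ℚ ≡ 0ℚ
·-zero zero    = ≡.refl
·-zero (suc i) = ≡.trans (ℚ.+-identityˡ _) (·-zero i)

coeff-θ : ∀ p i → coeff (θ p) i ≡ i · coeff p i
coeff-θ []      i       = ≡.sym (·-zero i)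
coeff-θ (a ∷ p) zero    = ≡.refl
coeff-θ (a ∷ p) (suc i) = ≡.trans (coeff-+ p (θ p) i) (≡.cong (coeff p i ℚ.+_) (coeff-θ p i))

θ-cong : ∀ {p q} → p ≋ q → θ p ≋ θ q
θ-cong {p} {q} e = ⟪ (λ i → ≡.trans (coeff-θ p i) (≡.trans (≡.cong (i ·_) (at e i)) (≡.sym (coeff-θ q i)))) ⟫

θ-+ : ∀ p q → θ (p +ᴾ q) ≋ θ p +ᴾ θ q
θ-+ p q = ⟪ (λ i → begin
  coeff (θ (p +ᴾ q)) i                 ≡⟨ coeff-θ (p +ᴾ q) i ⟩
  i · coeff (p +ᴾ q) i                 ≡⟨ ≡.cong (i ·_) (coeff-+ p q i) ⟩
  i · (coeff p i ℚ.+ coeff q i)        ≡⟨ ·-distrib i (coeff p i) (coeff q i) ⟩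
  i · coeff p i ℚ.+ i · coeff q i      ≡⟨ ≡.cong₂ ℚ._+_ (coeff-θ p i) (coeff-θ q i) ⟨
  coeff (θ p) i ℚ.+ coeff (θ q) i      ≡⟨ coeff-+ (θ p) (θ q) i ⟨
  coeff (θ p +ᴾ θ q) i                 ∎) ⟫
  where open ≡-Reasoning

θ-* : ∀ p q → θ (p *ᴾ q) ≋ θ p *ᴾ q +ᴾ p *ᴾ θ q
θ-* p q = ⟪ (λ i → begin
  coeff (θ (p *ᴾ q)) i                             ≡⟨ coeff-θ (p *ᴾ q) i ⟩
  i · coeff (p *ᴾ q) i                             ≡⟨ ≡.cong (i ·_) (coeff-* p q i) ⟩
  i · (coeff p ⋆ coeff q) i                        ≡⟨ ⋆-leibniz (coeff p) (coeff q) i ⟩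
  ((λ j → j · coeff p j) ⋆ coeff q) i ℚ.+ (coeff p ⋆ (λ j → j · coeff q j)) i
    ≡⟨ ≡.cong₂ ℚ._+_ (⋆-cong {g = coeff q} (coeff-θ p) (λ _ → ≡.refl) i) (⋆-cong {f = coeff p} (λ _ → ≡.refl) (coeff-θ q) i) ⟨
  (coeff (θ p) ⋆ coeff q) i ℚ.+ (coeff p ⋆ coeff (θ q)) i  ≡⟨ ≡.cong₂ ℚ._+_ (coeff-* (θ p) q i) (coeff-* p (θ q) i) ⟨
  coeff (θ p *ᴾ q) i ℚ.+ coeff (p *ᴾ θ q) i        ≡⟨ coeff-+ (θ p *ᴾ q) (p *ᴾ θ q) i ⟨
  coeff (θ p *ᴾ q +ᴾ p *ᴾ θ q) i                   ∎) ⟫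
  where open ≡-Reasoning

module 𝓟 = CommutativeRing polynomialRing
module 𝓟-convolution = Convolution polynomialRing
open Algebra.Definitions.RawMonoid 𝓟.+-rawMonoid using () renaming (_×_ to _·ᴾ_)

constant-* : ∀ a b → constant a *ᴾ constant b ≋ constant (a ℚ.* b)
constant-* a b = ⟪ (λ { zero → ℚ.+-identityʳ (a ℚ.* b) ; (suc i) → ≡.refl }) ⟫

constant-0 : constant 0ℚ ≋ []
constant-0 = ⟪ (λ { zero → ≡.refl ; (suc i) → ≡.refl }) ⟫

constant-cong : ∀ {a b} → a ≡ b → constant a ≋ constant b
constant-cong ≡.refl = 𝓟.refl

coeff-X* : ∀ p i → coeff (indeterminate *ᴾ p) (suc i) ≡ coeff p i
coeff-X* p i = begin
  coeff (indeterminate *ᴾ p) (suc i)                      ≡⟨ coeff-∷* 0ℚ (constant 1ℚ) p (suc i) ⟩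
  0ℚ ℚ.* coeff p (suc i) ℚ.+ coeff (constant 1ℚ *ᴾ p) i   ≡⟨ ≡.cong₂ ℚ._+_ (ℚ.*-zeroˡ (coeff p (suc i))) (at (𝓟.*-identityˡ p) i) ⟩
  0ℚ ℚ.+ coeff p i                                        ≡⟨ ℚ.+-identityˡ (coeff p i) ⟩
  coeff p i                                               ∎
  where open ≡-Reasoning

X*≈0∷ : ∀ p → indeterminate *ᴾ p ≋ 0ℚ ∷ p
X*≈0∷ p = ⟪ (λ { zero → ≡.trans (coeff-∷* 0ℚ (constant 1ℚ) p 0) (≡.trans (ℚ.+-identityʳ _) (ℚ.*-zeroˡ (coeff p 0)))
              ; (suc i) → coeff-X* p i }) ⟫

coeff-·ᴾ : ∀ n p i → coeff (n ·ᴾ p) i ≡ n · coeff p i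
coeff-·ᴾ zero    p i = ≡.refl
coeff-·ᴾ (suc n) p i = ≡.trans (coeff-+ p (n ·ᴾ p) i) (≡.cong (coeff p i ℚ.+_) (coeff-·ᴾ n p i))

cancel-neg : ∀ p q → (p +ᴾ (-ᴾ q)) +ᴾ q ≋ p
cancel-neg p q = 𝓟.trans (𝓟.+-assoc p (-ᴾ q) q) (𝓟.trans (𝓟.+-congˡ (𝓟.-‿inverseˡ q)) (𝓟.+-identityʳ p))

X-_ : ℚ → Polynomial
X- a = indeterminate +ᴾ (-ᴾ constant a)

coeff-X-* : ∀ a p i → coeff ((X- a) *ᴾ p) (suc i) ≡ coeff p i ℚ.- a ℚ.* coeff p (suc i)
coeff-X-* a p i = begin
  coeff ((X- a) *ᴾ p) (suc i)
    ≡⟨ coeff-∷* (0ℚ ℚ.+ (ℚ.- a)) (constant 1ℚ) p (suc i) ⟩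
  (0ℚ ℚ.+ (ℚ.- a)) ℚ.* coeff p (suc i) ℚ.+ coeff (constant 1ℚ *ᴾ p) i
    ≡⟨ ≡.cong ((0ℚ ℚ.+ (ℚ.- a)) ℚ.* coeff p (suc i) ℚ.+_) (at (𝓟.*-identityˡ p) i) ⟩
  (0ℚ ℚ.+ (ℚ.- a)) ℚ.* coeff p (suc i) ℚ.+ coeff p i
    ≡⟨ solve 3 (λ a b c → (con 0ℚ :+ (:- a)) :* c :+ b := b :- a :* c) ≡.refl a (coeff p i) (coeff p (suc i)) ⟩
  coeff p i ℚ.- a ℚ.* coeff p (suc i)  ∎
  where
  open ≡-Reasoning
  open +-*-Solver using (solve; _:=_; _:+_; _:*_; _:-_; :-_; con)

-- Multiplication by x^r, which brings the coefficient `r` places below degree `n` to the fixed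
-- index `n`. For `r` above `n` a prepended zero is found there, in agreement with the default of
-- `coeffFromTop`.
shift : ℕ → Polynomial → Polynomial
shift zero    p = p
shift (suc r) p = 0ℚ ∷ shift r p

coeff-shift : ∀ n p r → coeff (shift r p) n ≡ coeffFromTop n p r
coeff-shift n       p zero          = ≡.refl
coeff-shift zero    p (suc r)       = ≡.refl
-- The comparison inside `coeffFromTop` reduces only once the predecessor of the index is known to
-- be zero or a successor.
coeff-shift (suc n) p (suc zero)    = coeff-shift n p zero
coeff-shift (suc n) p (suc (suc r)) = coeff-shift n p (suc r)

-- Addition in ℚ normalises by a gcd that does not reduce on a variable, so the equation is checked
-- on unnormalised fractions.
fromℕ-suc : ∀ n → fromℕ (suc n) ≡ 1ℚ ℚ.+ fromℕ n
fromℕ-suc n = ℚ.toℚᵘ-injective (ℚᵘ.≃-trans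
  (ℚᵘ.*≡* (≡.cong (ℤ._* ℤ.1ℤ) (≡.cong (λ i → ℤ.1ℤ ℤ.+ i) (≡.sym (ℤ.*-identityʳ (ℤ.+ n))))))
  (ℚᵘ.≃-sym (ℚ.toℚᵘ-homo-+ 1ℚ (fromℕ n))))

·≡fromℕ* : ∀ n x → n · x ≡ fromℕ n ℚ.* x
·≡fromℕ* zero    x = ≡.sym (ℚ.*-zeroˡ x)
·≡fromℕ* (suc n) x = begin
  x ℚ.+ n · x                    ≡⟨ ≡.cong₂ ℚ._+_ (≡.sym (ℚ.*-identityˡ x)) (·≡fromℕ* n x) ⟩
  1ℚ ℚ.* x ℚ.+ fromℕ n ℚ.* x     ≡⟨ ℚ.*-distribʳ-+ x 1ℚ (fromℕ n) ⟨
  (1ℚ ℚ.+ fromℕ n) ℚ.* x         ≡⟨ ≡.cong (ℚ._* x) (fromℕ-suc n) ⟨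
  fromℕ (suc n) ℚ.* x            ∎
  where open ≡-Reasoning

-- Evaluation of polynomials

module Evaluation (x : ℚ) where

  open ≡-Reasoning
  open +-*-Solver using (solve; _:=_; _:+_; _:*_; _:-_; :-_; con)

  eval-+ : ∀ p q → eval (p +ᴾ q) x ≡ eval p x ℚ.+ eval q x
  eval-+ []      q       = ≡.sym (ℚ.+-identityˡ (eval q x))
  eval-+ (a ∷ p) []      = ≡.sym (ℚ.+-identityʳ (eval (a ∷ p) x))
  eval-+ (a ∷ p) (b ∷ q) = begin
    a ℚ.+ b ℚ.+ x ℚ.* eval (p +ᴾ q) x  ≡⟨ ≡.cong (λ e → a ℚ.+ b ℚ.+ x ℚ.* e) (eval-+ p q) ⟩
    a ℚ.+ b ℚ.+ x ℚ.* (eval p x ℚ.+ eval q x)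
      ≡⟨ solve 5 (λ a b x p q → a :+ b :+ x :* (p :+ q) := (a :+ x :* p) :+ (b :+ x :* q)) ≡.refl a b x (eval p x) (eval q x) ⟩
    eval (a ∷ p) x ℚ.+ eval (b ∷ q) x  ∎

  eval-scale : ∀ a p → eval (map (a ℚ.*_) p) x ≡ a ℚ.* eval p x
  eval-scale a []      = ≡.sym (ℚ.*-zeroʳ a)
  eval-scale a (b ∷ p) = begin
    a ℚ.* b ℚ.+ x ℚ.* eval (map (a ℚ.*_) p) x  ≡⟨ ≡.cong (λ e → a ℚ.* b ℚ.+ x ℚ.* e) (eval-scale a p) ⟩
    a ℚ.* b ℚ.+ x ℚ.* (a ℚ.* eval p x)
      ≡⟨ solve 4 (λ a b x p → a :* b :+ x :* (a :* p) := a :* (b :+ x :* p)) ≡.refl a b x (eval p x) ⟩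
    a ℚ.* eval (b ∷ p) x  ∎

  eval-neg : ∀ p → eval (-ᴾ p) x ≡ ℚ.- eval p x
  eval-neg []      = ≡.refl
  eval-neg (a ∷ p) = begin
    ℚ.- a ℚ.+ x ℚ.* eval (-ᴾ p) x  ≡⟨ ≡.cong (λ e → ℚ.- a ℚ.+ x ℚ.* e) (eval-neg p) ⟩
    ℚ.- a ℚ.+ x ℚ.* (ℚ.- eval p x)
      ≡⟨ solve 3 (λ a x p → :- a :+ x :* (:- p) := :- (a :+ x :* p)) ≡.refl a x (eval p x) ⟩
    ℚ.- eval (a ∷ p) x  ∎

  eval-* : ∀ p q → eval (p *ᴾ q) x ≡ eval p x ℚ.* eval q x
  eval-* []      q = ≡.sym (ℚ.*-zeroˡ (eval q x))
  eval-* (a ∷ p) q = begin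
    eval (map (a ℚ.*_) q +ᴾ (0ℚ ∷ p *ᴾ q)) x  ≡⟨ eval-+ (map (a ℚ.*_) q) (0ℚ ∷ p *ᴾ q) ⟩
    eval (map (a ℚ.*_) q) x ℚ.+ (0ℚ ℚ.+ x ℚ.* eval (p *ᴾ q) x)
      ≡⟨ ≡.cong₂ (λ e f → e ℚ.+ (0ℚ ℚ.+ x ℚ.* f)) (eval-scale a q) (eval-* p q) ⟩
    a ℚ.* eval q x ℚ.+ (0ℚ ℚ.+ x ℚ.* (eval p x ℚ.* eval q x))
      ≡⟨ solve 4 (λ a x p q → a :* q :+ (con 0ℚ :+ x :* (p :* q)) := (a :+ x :* p) :* q) ≡.refl a x (eval p x) (eval q x) ⟩
    eval (a ∷ p) x ℚ.* eval q x  ∎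

  infix  4 _⇓_
  infix  8 ⊖_
  infixl 6 _⊕_
  infixl 7 _⊗_

  -- As a record it lets the polynomial and its value be inferred from a derivation. The combinators
  -- below copy the shape of a polynomial expression and produce its value.
  record _⇓_ (p : Polynomial) (a : ℚ) : Set where
    constructor ⇓⟨_⟩
    field
      value : eval p x ≡ a

  _⊕_ : ∀ {p q a b} → p ⇓ a → q ⇓ b → p +ᴾ q ⇓ a ℚ.+ b
  _⊕_ {p} {q} ⇓⟨ e ⟩ ⇓⟨ f ⟩ = ⇓⟨ ≡.trans (eval-+ p q) (≡.cong₂ ℚ._+_ e f) ⟩

  _⊗_ : ∀ {p q a b} → p ⇓ a → q ⇓ b → p *ᴾ q ⇓ a ℚ.* b
  _⊗_ {p} {q} ⇓⟨ e ⟩ ⇓⟨ f ⟩ = ⇓⟨ ≡.trans (eval-* p q) (≡.cong₂ ℚ._*_ e f) ⟩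

  ⊖_ : ∀ {p a} → p ⇓ a → -ᴾ p ⇓ ℚ.- a
  ⊖_ {p} ⇓⟨ e ⟩ = ⇓⟨ ≡.trans (eval-neg p) (≡.cong ℚ.-_ e) ⟩

  constant⇓ : ∀ a → constant a ⇓ a
  constant⇓ a = ⇓⟨ ≡.trans (≡.cong (a ℚ.+_) (ℚ.*-zeroʳ x)) (ℚ.+-identityʳ a) ⟩

-- Leading coefficients and the degree of the characteristic polynomial

module _ where
  open FiniteSums polynomialRing using () renaming (sum to sumᴾ)
  open FiniteSums ℚ.+-*-commutativeRing using (sum)
  open Determinant polynomialRing using (det′; sign; minor)
  open Determinant ℚ.+-*-commutativeRing using () renaming (det′ to detℚ; sign to signℚ; minor to minorℚ)

  leads-sum : ∀ {n d} (f : Fin n → Polynomial) (a : Fin n → ℚ) →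
              (∀ j → Leads (coeff (f j)) d (a j)) → Leads (coeff (sumᴾ f)) d (sum a)
  leads-sum {zero}  f a lead = ≡.refl , λ _ _ → ≡.refl
  leads-sum {suc n} f a lead =
      ≡.trans (coeff-+ (f zero) _ _) (≡.cong₂ ℚ._+_ (proj₁ (lead zero)) (proj₁ IH))
    , λ i d<i → ≡.trans (coeff-+ (f zero) _ i) (≡.cong₂ ℚ._+_ (proj₂ (lead zero) i d<i) (proj₂ IH i d<i))
    where IH = leads-sum (f ∘ suc) (a ∘ suc) (lead ∘ suc)

  leads-* : ∀ {p q d e a b} → Leads (coeff p) d a → Leads (coeff q) e b → Leads (coeff (p *ᴾ q)) (d ℕ.+ e) (a ℚ.* b)
  leads-* {p} {q} lp lq = ≡.trans (coeff-* p q _) (proj₁ l) , λ i i> → ≡.trans (coeff-* p q i) (proj₂ l i i>)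
    where l = ⋆-leads lp lq

  open Algebra.Definitions.RawSemiring (RawRing.rawSemiring 𝓟.rawRing) using () renaming (_^_ to _^ᴾ_)
  open Algebra.Definitions.RawSemiring (RawRing.rawSemiring polynomialRawRing) using () renaming (_^_ to _^ᴿ_)
  open Algebra.Definitions.RawSemiring (RawRing.rawSemiring ℚ-ring.rawRing) using (_^_)

  leads-constant : ∀ a → Leads (coeff (constant a)) 0 a
  leads-constant a = ≡.refl , λ { (suc i) _ → ≡.refl }

  leads-sign : ∀ j → Leads (coeff ((-ᴾ constant 1ℚ) ^ᴾ j)) 0 ((ℚ.- 1ℚ) ^ j)
  leads-sign zero    = leads-constant 1ℚ
  leads-sign (suc j) = leads-* { -ᴾ constant 1ℚ} {(-ᴾ constant 1ℚ) ^ᴾ j} (leads-constant (ℚ.- 1ℚ)) (leads-sign j)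

  -- Leading coefficients multiply and add along the Laplace expansion, where each of the `n` rows
  -- contributes one degree. The coefficient of x^n is thus the determinant of the x-coefficients.
  det-leads : ∀ {n} (M : Matrix Polynomial n) (B : Matrix ℚ n) →
              (∀ i j → Leads (coeff (M i j)) 1 (B i j)) → Leads (coeff (det′ M)) n (detℚ B)
  det-leads {zero}  M B lead = leads-constant 1ℚ
  det-leads {suc n} M B lead = leads-sum
    (λ j → sign j *ᴾ M zero j *ᴾ det′ (minor M j)) (λ j → signℚ j ℚ.* B zero j ℚ.* detℚ (minorℚ B j))
    λ j → leads-* {sign j *ᴾ M zero j} {det′ (minor M j)} (leads-* {sign j} {M zero j} (leads-sign (toℕ j)) (lead zero j))
            (det-leads (minor M j) (minorℚ B j) λ i k → lead (suc i) (punchIn j k))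

  charMatrix : ∀ {n} → Matrix ℚ n → Matrix Polynomial n
  charMatrix A i j = (if does (i Fin.≟ j) then indeterminate else []) +ᴾ (-ᴾ constant (A i j))

  -- polynomialRawRing and 𝓟.rawRing differ in their equality, which det ignores.
  det-rawRing : ∀ {n} (M : Matrix Polynomial n) → det polynomialRawRing M ≡ det′ M
  det-rawRing {zero}  M = ≡.refl
  det-rawRing {suc n} M = sum-cong-≗ {suc n}
    {λ j → (-ᴾ constant 1ℚ) ^ᴿ toℕ j *ᴾ M zero j *ᴾ det polynomialRawRing (minor M j)}
    {λ j → sign j *ᴾ M zero j *ᴾ det′ (minor M j)}
    λ j → ≡.cong₂ (λ s d → s *ᴾ M zero j *ᴾ d) (power (toℕ j)) (det-rawRing (minor M j))
    where
    open FiniteSums polynomialRing using (sum-cong-≗)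
    power : ∀ {p} j → p ^ᴿ j ≡ p ^ᴾ j
    power zero        = ≡.refl
    power {p} (suc j) = ≡.cong (p *ᴾ_) (power j)

  charPoly-det : ∀ {n} (A : Matrix ℚ n) → charPoly A ≡ det′ (charMatrix A)
  charPoly-det A = det-rawRing (charMatrix A)

  -- The x-coefficients of the entries of x I - A form the identity matrix, whose determinant is 1.
  charPoly-monic : ∀ {n} (A : Matrix ℚ n) → Leads (coeff (charPoly A)) n 1ℚ
  charPoly-monic {n} A rewrite charPoly-det A = ≡.trans (proj₁ lead) (Determinant.det-δ ℚ.+-*-commutativeRing n) , proj₂ lead
    where
    open FiniteSums ℚ.+-*-commutativeRing using (δ)
    entry : ∀ i j → Leads (coeff (charMatrix A i j)) 1 (δ i j)
    entry i j with i Fin.≟ j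
    ... | yes _ = ≡.refl , λ { (suc zero) (s≤s ()) ; (suc (suc _)) _ → ≡.refl }
    ... | no _  = ≡.refl , λ { (suc _) _ → ≡.refl }
    lead = det-leads (charMatrix A) δ entry

-- Strongly regular graphs

module ℚSums = FiniteSums ℚ.+-*-commutativeRing

fromℕ-∣∣ : ∀ {n} (p : Subset n) → fromℕ ∣ p ∣ ≡ ℚSums.sum (λ i → if lookup p i then 1ℚ else 0ℚ)
fromℕ-∣∣ []          = ≡.refl
fromℕ-∣∣ (true ∷ p)  = ≡.trans (fromℕ-suc ∣ p ∣) (≡.cong (1ℚ ℚ.+_) (fromℕ-∣∣ p))
fromℕ-∣∣ (false ∷ p) = ≡.trans (fromℕ-∣∣ p) (≡.sym (ℚ.+-identityˡ _))

module AdjacencyMatrix (G : Graph) where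
  open Graph G
  open ℚSums
  open ≡-Reasoning

  row-sum : ∀ u → sum (adjacencyMatrix u) ≡ fromℕ ∣ neighbours u ∣
  row-sum u = ≡.trans
    (sum-cong-≗ λ w → ≡.cong (if_then 1ℚ else 0ℚ) (≡.sym (Vec.lookup∘tabulate (λ w → does (u ∼? w)) w)))
    (≡.sym (fromℕ-∣∣ (neighbours u)))

  does-sym : ∀ u w → does (u ∼? w) ≡ does (w ∼? u)
  does-sym u w = does-⇔ (mk⇔ ∼-sym ∼-sym) (u ∼? w) (w ∼? u)

  diagonal : ∀ u → adjacencyMatrix u u ≡ 0ℚ
  diagonal u = ≡.cong (if_then 1ℚ else 0ℚ) (dec-false (u ∼? u) (∼-irrefl ≡.refl))

  -- The sum counts walks of length two from `u` to `w`; by symmetry of `_∼_` their midpoints are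
  -- the common neighbours.
  square-entry : ∀ u w → sum (λ a → adjacencyMatrix u a ℚ.* adjacencyMatrix a w) ≡ fromℕ ∣ neighbours u ∩ neighbours w ∣
  square-entry u w = ≡.trans (sum-cong-≗ entry) (≡.sym (fromℕ-∣∣ (neighbours u ∩ neighbours w)))
    where
    indicator-∧ : ∀ a b → (if a then 1ℚ else 0ℚ) ℚ.* (if b then 1ℚ else 0ℚ) ≡ (if a ∧ b then 1ℚ else 0ℚ)
    indicator-∧ false false = ≡.refl
    indicator-∧ false true  = ≡.refl
    indicator-∧ true  false = ≡.refl
    indicator-∧ true  true  = ≡.refl
    entry : ∀ a → adjacencyMatrix u a ℚ.* adjacencyMatrix a w ≡ (if lookup (neighbours u ∩ neighbours w) a then 1ℚ else 0ℚ)
    entry a = ≡.trans (indicator-∧ (does (u ∼? a)) (does (a ∼? w))) (≡.cong (if_then 1ℚ else 0ℚ) (begin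
      does (u ∼? a) ∧ does (a ∼? w)  ≡⟨ ≡.cong (does (u ∼? a) ∧_) (does-sym a w) ⟩
      does (u ∼? a) ∧ does (w ∼? a)
        ≡⟨ ≡.cong₂ _∧_ (Vec.lookup∘tabulate (λ b → does (u ∼? b)) a) (Vec.lookup∘tabulate (λ b → does (w ∼? b)) a) ⟨
      lookup (neighbours u) a ∧ lookup (neighbours w) a  ≡⟨ Vec.lookup-zipWith _∧_ a (neighbours u) (neighbours w) ⟨
      lookup (neighbours u ∩ neighbours w) a  ∎))

  module _ {v k l m} (srg : IsStronglyRegular G v k l m) where
    open IsStronglyRegular srg

    -- The coefficients are forced by the three kinds of entries: the right side has to be `k` on
    -- the diagonal, where `A` vanishes, `l` on edges and `m` elsewhere.
    square : ∀ u w → sum (λ a → adjacencyMatrix u a ℚ.* adjacencyMatrix a w) ≡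
      (fromℕ k ℚ.- fromℕ m) ℚ.* δ u w ℚ.+ (fromℕ l ℚ.- fromℕ m) ℚ.* adjacencyMatrix u w ℚ.+ fromℕ m
    square u w = ≡.trans (square-entry u w) (count u w)
      where
      open +-*-Solver using (solve; _:=_; _:+_; _:*_; _:-_; :-_; con)
      count : ∀ u w → fromℕ ∣ neighbours u ∩ neighbours w ∣ ≡
        (fromℕ k ℚ.- fromℕ m) ℚ.* δ u w ℚ.+ (fromℕ l ℚ.- fromℕ m) ℚ.* adjacencyMatrix u w ℚ.+ fromℕ m
      count u w with u Fin.≟ w
      ... | yes ≡.refl = begin
        fromℕ ∣ neighbours u ∩ neighbours u ∣  ≡⟨ ≡.cong (λ p → fromℕ ∣ p ∣) (Subset.∩-idem (neighbours u)) ⟩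
        fromℕ ∣ neighbours u ∣                 ≡⟨ ≡.cong fromℕ (regular u) ⟩
        fromℕ k
          ≡⟨ solve 3 (λ k l m → k := (k :- m) :* con 1ℚ :+ (l :- m) :* con 0ℚ :+ m) ≡.refl (fromℕ k) (fromℕ l) (fromℕ m) ⟩
        (fromℕ k ℚ.- fromℕ m) ℚ.* 1ℚ ℚ.+ (fromℕ l ℚ.- fromℕ m) ℚ.* 0ℚ ℚ.+ fromℕ m
          ≡⟨ ≡.cong (λ a → (fromℕ k ℚ.- fromℕ m) ℚ.* 1ℚ ℚ.+ (fromℕ l ℚ.- fromℕ m) ℚ.* a ℚ.+ fromℕ m) (diagonal u) ⟨
        (fromℕ k ℚ.- fromℕ m) ℚ.* 1ℚ ℚ.+ (fromℕ l ℚ.- fromℕ m) ℚ.* adjacencyMatrix u u ℚ.+ fromℕ m  ∎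
      ... | no u≢w with u ∼? w
      ...   | yes u∼w = ≡.trans (≡.cong fromℕ (adjacent u w u∼w))
        (solve 3 (λ k l m → l := (k :- m) :* con 0ℚ :+ (l :- m) :* con 1ℚ :+ m) ≡.refl (fromℕ k) (fromℕ l) (fromℕ m))
      ...   | no u≁w  = ≡.trans (≡.cong fromℕ (nonadjacent u w u≢w u≁w))
        (solve 3 (λ k l m → m := (k :- m) :* con 0ℚ :+ (l :- m) :* con 0ℚ :+ m) ≡.refl (fromℕ k) (fromℕ l) (fromℕ m))

-- The differential equation of the characteristic polynomial

module CharacteristicEquation (k s t m : ℚ) where

  Y Z P W : Polynomial
  Y = X- k
  Z = X- s
  P = indeterminate *ᴾ Y *ᴾ Z +ᴾ (-ᴾ (Y *ᴾ constant t))
  W = Y *ᴾ Z +ᴾ constant m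

  -- The equation satisfied by F = x^r χ, with θ = x d/dx.
  Solves : ℕ → ℕ → Polynomial → Set
  Solves n r F = P *ᴾ θ F ≋ r ·ᴾ (P *ᴾ F) +ᴾ indeterminate *ᴾ ((n ·ᴾ W) *ᴾ F)

  module _ {n} (A : Matrix ℚ n) where
    open FiniteSums ℚ.+-*-commutativeRing using () renaming (sum to sumℚ; δ to δℚ)
    open FiniteSums polynomialRing

    module _ (row : ∀ i → sumℚ (A i) ≡ k)
             (square : ∀ i c → sumℚ (λ a → A i a ℚ.* A a c) ≡ t ℚ.* δℚ i c ℚ.+ s ℚ.* A i c ℚ.+ m)
             (diagonal : ∀ i → A i i ≡ 0ℚ) where

      private
        A′ : Matrix Polynomial n
        A′ i j = constant (A i j)

        constant-sum : ∀ {n} (f : Fin n → ℚ) → sum (constant ∘ f) ≋ constant (sumℚ f)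
        constant-sum {zero}  f = 𝓟.sym constant-0
        constant-sum {suc n} f = 𝓟.+-congˡ (constant-sum (f ∘ suc))

        row′ : ∀ i → sum (A′ i) ≋ constant k
        row′ i = 𝓟.trans (constant-sum (A i)) (constant-cong (row i))

        constant-δ : ∀ i c → constant (δℚ i c) ≋ δ {n} i c
        constant-δ i c with i Fin.≟ c
        ... | yes _ = 𝓟.refl
        ... | no _  = constant-0

        square′ : ∀ i c → sum (λ a → A′ i a *ᴾ A′ a c) ≋ constant t *ᴾ δ i c +ᴾ constant s *ᴾ A′ i c +ᴾ constant m
        square′ i c = begin
          sum (λ a → A′ i a *ᴾ A′ a c)  ≈⟨ sum-cong-≋ (λ a → constant-* (A i a) (A a c)) ⟩
          sum (λ a → constant (A i a ℚ.* A a c))  ≈⟨ constant-sum (λ a → A i a ℚ.* A a c) ⟩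
          constant (sumℚ λ a → A i a ℚ.* A a c)   ≈⟨ constant-cong (square i c) ⟩
          constant (t ℚ.* δℚ i c) +ᴾ constant (s ℚ.* A i c) +ᴾ constant m
            ≈⟨ 𝓟.+-congʳ {constant m} (𝓟.+-cong
                 {constant (t ℚ.* δℚ i c)} {constant t *ᴾ δ i c} {constant (s ℚ.* A i c)} {constant s *ᴾ A′ i c}
                 (𝓟.trans (𝓟.sym (constant-* t (δℚ i c))) (𝓟.*-congˡ {constant t} (constant-δ i c)))
                 (𝓟.sym (constant-* s (A i c)))) ⟩
          constant t *ᴾ δ i c +ᴾ constant s *ᴾ A′ i c +ᴾ constant m  ∎
          where open import Relation.Binary.Reasoning.Setoid 𝓟.setoid

        M+A : ∀ i a → charMatrix A i a +ᴾ A′ i a ≋ indeterminate *ᴾ δ i a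
        M+A i a = 𝓟.trans (cancel-neg (if does (i Fin.≟ a) then indeterminate else []) (A′ i a)) (diagonal-X i a)
          where
          diagonal-X : ∀ i a → (if does (i Fin.≟ a) then indeterminate else []) ≋ indeterminate *ᴾ δ {n} i a
          diagonal-X i a with i Fin.≟ a
          ... | yes _ = 𝓟.sym (𝓟.*-identityʳ indeterminate)
          ... | no _  = 𝓟.sym (𝓟.zeroʳ indeterminate)

        -- `θ` fixes the indeterminate and kills constants. The scalar `u` of `d-det-scalar` is
        -- therefore the indeterminate, which is the origin of that factor in `Solves`.
        θM : ∀ i c → θ (charMatrix A i c) ≋ indeterminate *ᴾ δ i c
        θM i c with i Fin.≟ c
        ... | yes _ = ⟪ (λ { 0 → ≡.refl ; 1 → ≡.refl ; (suc (suc _)) → ≡.refl }) ⟫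
        ... | no _  = ⟪ (λ { 0 → ≡.refl ; (suc i) → ≡.sym (at (𝓟.zeroʳ indeterminate) (suc i)) }) ⟫

        X≈Y+k : indeterminate ≋ Y +ᴾ constant k
        X≈Y+k = 𝓟.sym (cancel-neg indeterminate (constant k))

        X≈Z+s : indeterminate ≋ Z +ᴾ constant s
        X≈Z+s = 𝓟.sym (cancel-neg indeterminate (constant s))

        P-eq : P +ᴾ Y *ᴾ constant t ≋ indeterminate *ᴾ Y *ᴾ Z
        P-eq = cancel-neg (indeterminate *ᴾ Y *ᴾ Z) (Y *ᴾ constant t)

        open StronglyRegularMatrix.Multiplier polynomialRing A′ (charMatrix A)
          indeterminate Y Z (constant k) (constant s) (constant t) (constant m) P
          X≈Y+k X≈Z+s P-eq row′ square′ M+A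

        open Determinant.Derivation polynomialRing θ θ-cong θ-+ θ-*

      charPoly-solves : Solves n 0 (charPoly A)
      charPoly-solves rewrite charPoly-det A = 𝓟.trans
        (d-det-scalar (charMatrix A) N P indeterminate θM N-multiplies)
        (𝓟.*-congˡ {indeterminate} (𝓟.*-congʳ
          {Determinant.det′ polynomialRing (charMatrix A)} {sum λ c → N c c} {n ·ᴾ W}
          (N-trace λ i → 𝓟.trans (constant-cong (diagonal i)) constant-0)))

  solves-shift : ∀ n r F → Solves n r F → Solves n (suc r) (0ℚ ∷ F)
  solves-shift n r F solvesF = begin
    P *ᴾ (0ℚ ∷ (F +ᴾ θ F))              ≈⟨ 𝓟.*-congˡ {P} (X*≈0∷ (F +ᴾ θ F)) ⟨
    P *ᴾ (indeterminate *ᴾ (F +ᴾ θ F))  ≈⟨ EulerOperator.multiply-by-x polynomialRing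
                                             {indeterminate} {P} {n ·ᴾ W} {F} {θ F} r solvesF ⟩
    right (indeterminate *ᴾ F)          ≈⟨ 𝓟.+-cong
                                             (×-congʳ (suc r) (𝓟.*-congˡ {P} (X*≈0∷ F)))
                                             (𝓟.*-congˡ {indeterminate} (𝓟.*-congˡ {n ·ᴾ W} (X*≈0∷ F))) ⟩
    right (0ℚ ∷ F)                      ∎
    where
    open import Relation.Binary.Reasoning.Setoid 𝓟.setoid
    open Algebra.Properties.Monoid.Mult 𝓟.+-monoid using (×-congʳ)
    right : Polynomial → Polynomial
    right G = suc r ·ᴾ (P *ᴾ G) +ᴾ indeterminate *ᴾ ((n ·ᴾ W) *ᴾ G)

  shift-solves : ∀ n r F → Solves n 0 F → Solves n r (shift r F)
  shift-solves n zero    F solvesF = solvesF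
  shift-solves n (suc r) F solvesF = solves-shift n r (shift r F) (shift-solves n r F solvesF)

-- The recurrence for the coefficients

module Coefficients (k s t m : ℚ) where
  open CharacteristicEquation k s t m
  open ≡-Reasoning
  open +-*-Solver using (solve; _:=_; _:+_; _:*_; _:-_; con)

  -- The arguments are coefficients of `F` in consecutive increasing degrees, and the value is the
  -- coefficient of (x - k)(x - s) F in the degree of the last one. The function `cubic` does the
  -- same for `P`.
  yz : ℚ → ℚ → ℚ → ℚ
  yz a b c = (a ℚ.- s ℚ.* b) ℚ.- k ℚ.* (b ℚ.- s ℚ.* c)

  cubic : ℚ → ℚ → ℚ → ℚ → ℚ
  cubic a b c d = yz a b c ℚ.- t ℚ.* (c ℚ.- k ℚ.* d)

  coeff-YZ : ∀ F i → coeff (Y *ᴾ (Z *ᴾ F)) (2 ℕ.+ i) ≡ yz (coeff F i) (coeff F (1 ℕ.+ i)) (coeff F (2 ℕ.+ i))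
  coeff-YZ F i = ≡.trans (coeff-X-* k (Z *ᴾ F) (1 ℕ.+ i))
    (≡.cong₂ (λ a b → a ℚ.- k ℚ.* b) (coeff-X-* s F i) (coeff-X-* s F (1 ℕ.+ i)))

  coeff-P : ∀ F i → coeff (P *ᴾ F) (3 ℕ.+ i) ≡
    cubic (coeff F i) (coeff F (1 ℕ.+ i)) (coeff F (2 ℕ.+ i)) (coeff F (3 ℕ.+ i))
  coeff-P F i = begin
    coeff (P *ᴾ F) (3 ℕ.+ i)  ≡⟨ at expand (3 ℕ.+ i) ⟩
    coeff (indeterminate *ᴾ (Y *ᴾ (Z *ᴾ F)) +ᴾ (-ᴾ (constant t *ᴾ (Y *ᴾ F)))) (3 ℕ.+ i)
      ≡⟨ coeff-+ (indeterminate *ᴾ (Y *ᴾ (Z *ᴾ F))) (-ᴾ (constant t *ᴾ (Y *ᴾ F))) (3 ℕ.+ i) ⟩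
    coeff (indeterminate *ᴾ (Y *ᴾ (Z *ᴾ F))) (3 ℕ.+ i) ℚ.+ coeff (-ᴾ (constant t *ᴾ (Y *ᴾ F))) (3 ℕ.+ i)
      ≡⟨ ≡.cong₂ ℚ._+_
           (≡.trans (coeff-X* (Y *ᴾ (Z *ᴾ F)) (2 ℕ.+ i)) (coeff-YZ F i))
           (≡.trans (coeff-neg (constant t *ᴾ (Y *ᴾ F)) (3 ℕ.+ i)) (≡.cong ℚ.-_
             (≡.trans (coeff-constant t (Y *ᴾ F) (3 ℕ.+ i)) (≡.cong (t ℚ.*_) (coeff-X-* k F (2 ℕ.+ i)))))) ⟩
    cubic (coeff F i) (coeff F (1 ℕ.+ i)) (coeff F (2 ℕ.+ i)) (coeff F (3 ℕ.+ i))  ∎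
    where
    open Algebra.Properties.Ring 𝓟.ring using (-‿distribˡ-*)
    expand : P *ᴾ F ≋ indeterminate *ᴾ (Y *ᴾ (Z *ᴾ F)) +ᴾ (-ᴾ (constant t *ᴾ (Y *ᴾ F)))
    expand = 𝓟.trans (𝓟.distribʳ F (indeterminate *ᴾ Y *ᴾ Z) (-ᴾ (Y *ᴾ constant t)))
      (𝓟.+-cong
        (𝓟.trans (𝓟.*-assoc (indeterminate *ᴾ Y) Z F) (𝓟.*-assoc indeterminate Y (Z *ᴾ F)))
        (𝓟.trans (𝓟.sym (-‿distribˡ-* (Y *ᴾ constant t) F)) (𝓟.-‿cong
          (𝓟.trans (𝓟.*-congʳ {F} (𝓟.*-comm Y (constant t))) (𝓟.*-assoc (constant t) Y F)))))

  coeff-U : ∀ n F i → coeff (indeterminate *ᴾ ((n ·ᴾ W) *ᴾ F)) (3 ℕ.+ i) ≡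
    fromℕ n ℚ.* (yz (coeff F i) (coeff F (1 ℕ.+ i)) (coeff F (2 ℕ.+ i)) ℚ.+ m ℚ.* coeff F (2 ℕ.+ i))
  coeff-U n F i = begin
    coeff (indeterminate *ᴾ ((n ·ᴾ W) *ᴾ F)) (3 ℕ.+ i)  ≡⟨ coeff-X* ((n ·ᴾ W) *ᴾ F) (2 ℕ.+ i) ⟩
    coeff ((n ·ᴾ W) *ᴾ F) (2 ℕ.+ i)                     ≡⟨ at multiple (2 ℕ.+ i) ⟩
    coeff (n ·ᴾ (F *ᴾ W)) (2 ℕ.+ i)                     ≡⟨ coeff-·ᴾ n (F *ᴾ W) (2 ℕ.+ i) ⟩
    n · coeff (F *ᴾ W) (2 ℕ.+ i)                        ≡⟨ ·≡fromℕ* n _ ⟩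
    fromℕ n ℚ.* coeff (F *ᴾ W) (2 ℕ.+ i)                ≡⟨ ≡.cong (fromℕ n ℚ.*_) (at expand (2 ℕ.+ i)) ⟩
    fromℕ n ℚ.* coeff (Y *ᴾ (Z *ᴾ F) +ᴾ constant m *ᴾ F) (2 ℕ.+ i)
      ≡⟨ ≡.cong (fromℕ n ℚ.*_) (≡.trans (coeff-+ (Y *ᴾ (Z *ᴾ F)) (constant m *ᴾ F) (2 ℕ.+ i))
           (≡.cong₂ ℚ._+_ (coeff-YZ F i) (coeff-constant m F (2 ℕ.+ i)))) ⟩
    fromℕ n ℚ.* (yz (coeff F i) (coeff F (1 ℕ.+ i)) (coeff F (2 ℕ.+ i)) ℚ.+ m ℚ.* coeff F (2 ℕ.+ i))  ∎
    where
    multiple : (n ·ᴾ W) *ᴾ F ≋ n ·ᴾ (F *ᴾ W)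
    multiple = 𝓟.trans (𝓟.*-comm (n ·ᴾ W) F) (𝓟.sym (𝓟-convolution.·-assoc n F W))
    expand : F *ᴾ W ≋ Y *ᴾ (Z *ᴾ F) +ᴾ constant m *ᴾ F
    expand = 𝓟.trans (𝓟.*-comm F W) (𝓟.trans (𝓟.distribʳ F (Y *ᴾ Z) (constant m))
      (𝓟.+-congʳ {constant m *ᴾ F} (𝓟.*-assoc Y Z F)))

  -- With `F` = x^(r+1) χ, `ν` = n and `ρ` = r, the arguments `b`, `c`, `d` are c_r, c_(r-1),
  -- c_(r-2). The formula solves the comparison of coefficients for (r + 1) c_(r+1).
  next : ℚ → ℚ → ℚ → ℚ → ℚ → ℚ
  next ν ρ b c d =
    (s ℚ.+ k) ℚ.* ρ ℚ.* b
      ℚ.- ((k ℚ.* s ℚ.- t) ℚ.* (ρ ℚ.- 1ℚ) ℚ.+ ν ℚ.* (t ℚ.+ m)) ℚ.* c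
      ℚ.+ k ℚ.* t ℚ.* (ν ℚ.+ (1ℚ ℚ.+ 1ℚ ℚ.- ρ)) ℚ.* d

  -- The coefficients of x^(n+3) on both sides of the differential equation.
  recurrence : ∀ n r F → Solves n (suc r) F →
    fromℕ (suc r) ℚ.* coeff F n ≡
      next (fromℕ n) (fromℕ r) (coeff F (1 ℕ.+ n)) (coeff F (2 ℕ.+ n)) (coeff F (3 ℕ.+ n))
  recurrence n r F solvesF = begin
    fromℕ (suc r) ℚ.* a           ≡⟨ ≡.cong (ℚ._* a) (fromℕ-suc r) ⟩
    (1ℚ ℚ.+ ρ) ℚ.* a
      -- An identity in independent variables: the difference of the two sides of the equation is (1
      -- + ρ) a minus the target. The differential equation enters afterwards, when it makes that
      -- difference vanish.
      ≡⟨ solve 10 (λ k s t m ν ρ a b c d →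
           let one     = con 1ℚ
               yz      = λ a b c → (a :- s :* b) :- k :* (b :- s :* c)
               cubic   = λ a b c d → yz a b c :- t :* (c :- k :* d)
           in (one :+ ρ) :* a :=
              ((s :+ k) :* ρ :* b :- ((k :* s :- t) :* (ρ :- one) :+ ν :* (t :+ m)) :* c
                :+ k :* t :* (ν :+ (one :+ one :- ρ)) :* d)
              :+ (((one :+ ρ) :* cubic a b c d :+ ν :* (yz a b c :+ m :* c))
                  :- cubic (ν :* a) ((one :+ ν) :* b) ((one :+ (one :+ ν)) :* c) ((one :+ (one :+ (one :+ ν))) :* d)))
           ≡.refl k s t m ν ρ a b c d ⟩
    target ℚ.+ (right ℚ.- left)   ≡⟨ ≡.cong (λ x → target ℚ.+ (right ℚ.- x)) compare ⟩
    target ℚ.+ (right ℚ.- right)  ≡⟨ ≡.cong (target ℚ.+_) (ℚ.+-inverseʳ right) ⟩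
    target ℚ.+ 0ℚ                 ≡⟨ ℚ.+-identityʳ target ⟩
    target                        ∎
    where
    ν = fromℕ n
    ρ = fromℕ r
    a = coeff F n
    b = coeff F (1 ℕ.+ n)
    c = coeff F (2 ℕ.+ n)
    d = coeff F (3 ℕ.+ n)
    target = next ν ρ b c d
    left   = cubic (ν ℚ.* a) ((1ℚ ℚ.+ ν) ℚ.* b) ((1ℚ ℚ.+ (1ℚ ℚ.+ ν)) ℚ.* c) ((1ℚ ℚ.+ (1ℚ ℚ.+ (1ℚ ℚ.+ ν))) ℚ.* d)
    right  = (1ℚ ℚ.+ ρ) ℚ.* cubic a b c d ℚ.+ ν ℚ.* (yz a b c ℚ.+ m ℚ.* c)
    coeff-θF : ∀ i {x} → fromℕ i ≡ x → x ℚ.* coeff F i ≡ coeff (θ F) i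
    coeff-θF i ≡.refl = ≡.sym (≡.trans (coeff-θ F i) (·≡fromℕ* i (coeff F i)))
    from1 = fromℕ-suc n
    from2 = ≡.trans (fromℕ-suc (1 ℕ.+ n)) (≡.cong (1ℚ ℚ.+_) from1)
    from3 = ≡.trans (fromℕ-suc (2 ℕ.+ n)) (≡.cong (1ℚ ℚ.+_) from2)
    compare : left ≡ right
    compare = begin
      left
        ≡⟨ ≡.cong₂ (λ f x → f x)
             (≡.cong₂ (λ f x → f x) (≡.cong₂ cubic (coeff-θF n ≡.refl) (coeff-θF (1 ℕ.+ n) from1)) (coeff-θF (2 ℕ.+ n) from2))
             (coeff-θF (3 ℕ.+ n) from3) ⟩
      cubic (coeff (θ F) n) (coeff (θ F) (1 ℕ.+ n)) (coeff (θ F) (2 ℕ.+ n)) (coeff (θ F) (3 ℕ.+ n))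
        ≡⟨ coeff-P (θ F) n ⟨
      coeff (P *ᴾ θ F) (3 ℕ.+ n)
        ≡⟨ at solvesF (3 ℕ.+ n) ⟩
      coeff (suc r ·ᴾ (P *ᴾ F) +ᴾ indeterminate *ᴾ ((n ·ᴾ W) *ᴾ F)) (3 ℕ.+ n)
        ≡⟨ coeff-+ (suc r ·ᴾ (P *ᴾ F)) (indeterminate *ᴾ ((n ·ᴾ W) *ᴾ F)) (3 ℕ.+ n) ⟩
      coeff (suc r ·ᴾ (P *ᴾ F)) (3 ℕ.+ n) ℚ.+ coeff (indeterminate *ᴾ ((n ·ᴾ W) *ᴾ F)) (3 ℕ.+ n)
        ≡⟨ ≡.cong₂ ℚ._+_
             (≡.trans (coeff-·ᴾ (suc r) (P *ᴾ F) (3 ℕ.+ n)) (≡.trans (·≡fromℕ* (suc r) (coeff (P *ᴾ F) (3 ℕ.+ n)))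
               (≡.cong₂ ℚ._*_ (fromℕ-suc r) (coeff-P F n))))
             (coeff-U n F n) ⟩
      right  ∎

-- Coefficients as polynomials in q

module CoefficientPolynomials (v k l m : Polynomial) where

  s t : Polynomial
  s = l +ᴾ (-ᴾ m)
  t = k +ᴾ (-ᴾ m)

  -- φ r j is the coefficient of x^(v + j - r).
  φ : ℕ → ℕ → Polynomial
  φ zero    zero    = constant 1ℚ
  φ zero    (suc j) = []
  φ (suc r) (suc j) = φ r j
  -- The second indices 0, 1, 2 give c_r, c_(r-1), c_(r-2). For `r` below 2 some of these reach the
  -- zeros above the leading term, so the recurrence needs no initial value besides the leading 1.
  φ (suc r) zero    = constant (ℚ.1/ fromℕ (suc r)) *ᴾ
    ( (s +ᴾ k) *ᴾ constant (fromℕ r) *ᴾ φ r 0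
      +ᴾ (-ᴾ (((k *ᴾ s +ᴾ (-ᴾ t)) *ᴾ constant (fromℕ r ℚ.- 1ℚ) +ᴾ v *ᴾ (t +ᴾ m)) *ᴾ φ r 1))
      +ᴾ k *ᴾ t *ᴾ (v +ᴾ constant (1ℚ ℚ.+ 1ℚ ℚ.- fromℕ r)) *ᴾ φ r 2)

  module Correctness (x : ℚ) where

    open Evaluation x

    module _ {n k′ l′ m′}
      (v⇓ : v ⇓ fromℕ n) (k⇓ : k ⇓ k′) (l⇓ : l ⇓ l′) (m⇓ : m ⇓ m′) where

      open CharacteristicEquation k′ (l′ ℚ.- m′) (k′ ℚ.- m′) m′
      open Coefficients k′ (l′ ℚ.- m′) (k′ ℚ.- m′) m′
      open ≡-Reasoning

      -- Everything is compared at a single point `x`, where `v` takes the matrix size as its value,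
      -- so no identity between polynomials in q is required. Raising both indices leaves the
      -- coefficient of the shifted list unchanged by computation; only `j` = 0 calls for the
      -- recurrence.
      φ-correct : ∀ χ → Solves n 0 χ → Leads (coeff χ) n 1ℚ →
                  ∀ r j → φ r j ⇓ coeff (shift r χ) (j ℕ.+ n)
      φ-correct χ solvesχ (top , above) zero    zero    = ⇓⟨ ≡.trans (_⇓_.value (constant⇓ 1ℚ)) (≡.sym top) ⟩
      φ-correct χ solvesχ (top , above) zero    (suc j) = ⇓⟨ ≡.sym (above (suc (j ℕ.+ n)) (s≤s (ℕ.m≤n+m n j))) ⟩
      φ-correct χ solvesχ monic         (suc r) (suc j) = φ-correct χ solvesχ monic r j
      φ-correct χ solvesχ monic         (suc r) zero    = ⇓⟨ (begin
        eval (φ (suc r) 0) x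
          ≡⟨ _⇓_.value (constant⇓ (ℚ.1/ fromℕ (suc r)) ⊗
               ( (s⇓ ⊕ k⇓) ⊗ constant⇓ (fromℕ r) ⊗ φ⇓ 0
                 ⊕ ⊖ (((k⇓ ⊗ s⇓ ⊕ ⊖ t⇓) ⊗ constant⇓ (fromℕ r ℚ.- 1ℚ) ⊕ v⇓ ⊗ (t⇓ ⊕ m⇓)) ⊗ φ⇓ 1)
                 ⊕ k⇓ ⊗ t⇓ ⊗ (v⇓ ⊕ constant⇓ (1ℚ ℚ.+ 1ℚ ℚ.- fromℕ r)) ⊗ φ⇓ 2)) ⟩
        ℚ.1/ fromℕ (suc r) ℚ.* next (fromℕ n) (fromℕ r) (coeff F (1 ℕ.+ n)) (coeff F (2 ℕ.+ n)) (coeff F (3 ℕ.+ n))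
          ≡⟨ ≡.cong (ℚ.1/ fromℕ (suc r) ℚ.*_) (recurrence n r F (shift-solves n (suc r) χ solvesχ)) ⟨
        ℚ.1/ fromℕ (suc r) ℚ.* (fromℕ (suc r) ℚ.* coeff F n)
          ≡⟨ ℚ.*-assoc (ℚ.1/ fromℕ (suc r)) (fromℕ (suc r)) (coeff F n) ⟨
        ℚ.1/ fromℕ (suc r) ℚ.* fromℕ (suc r) ℚ.* coeff F n
          ≡⟨ ≡.cong (ℚ._* coeff F n) (ℚ.*-inverseˡ (fromℕ (suc r))) ⟩
        1ℚ ℚ.* coeff F n
          ≡⟨ ℚ.*-identityˡ (coeff F n) ⟩
        coeff F n  ∎) ⟩
        where
        F = shift (suc r) χ
        φ⇓ = φ-correct χ solvesχ monic r
        s⇓ : s ⇓ l′ ℚ.- m′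
        s⇓ = l⇓ ⊕ ⊖ m⇓
        t⇓ : t ⇓ k′ ℚ.- m′
        t⇓ = k⇓ ⊕ ⊖ m⇓

  coefficient-value : ∀ G q → IsStronglyRegularAt G v k l m q → ∀ r →
    coeffFromTop (Graph.order G) (graphCharPoly G) r ≡ eval (φ r 0) (fromℕ q)
  coefficient-value G q (_ , k′ , l′ , m′ , v≡ , k≡ , l≡ , m≡ , srg) r = begin
    coeffFromTop order (graphCharPoly G) r  ≡⟨ coeff-shift order (graphCharPoly G) r ⟨
    coeff (shift r (graphCharPoly G)) order
      ≡⟨ _⇓_.value (φ-correct
           ⇓⟨ ≡.trans v≡ (≡.cong fromℕ (≡.sym order≡v)) ⟩ ⇓⟨ k≡ ⟩ ⇓⟨ l≡ ⟩ ⇓⟨ m≡ ⟩ (graphCharPoly G)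
           (charPoly-solves adjacencyMatrix
             (λ u → ≡.trans (row-sum u) (≡.cong fromℕ (regular u))) (square srg) diagonal)
           (charPoly-monic adjacencyMatrix) r 0) ⟨
    eval (φ r 0) (fromℕ q)                  ∎
    where
    open Graph G
    open IsStronglyRegular srg
    open AdjacencyMatrix G
    open CharacteristicEquation (fromℕ k′) (fromℕ l′ ℚ.- fromℕ m′) (fromℕ k′ ℚ.- fromℕ m′) (fromℕ m′)
    open Evaluation (fromℕ q)
    open Correctness (fromℕ q)
    open ≡-Reasoning

-- Uniform coefficient polynomials for the family over `Q`

theorem2p5 : ∀ {ℓ} (Q : Pred ℕ ℓ) → Inf Q →
    (v k l m : Polynomial) →
    (G : ∀ q → q ∈ Q → Graph) →
    (∀ q (q∈Q : q ∈ Q) → IsStronglyRegularAt (G q q∈Q) v k l m q) →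
    (∀ r → ∃[ φ ] (∀ q (q∈Q : q ∈ Q) →
    coeffFromTop (Graph.order (G q q∈Q)) (graphCharPoly (G q q∈Q)) r
    ≡ eval φ (fromℕ q)))
    × TwoLevelPolynomial Q (λ q q∈Q → graphCharPoly (G q q∈Q)) v (λ _ _ → ⊤±)
theorem2p5 Q Q-infinite v k l m G srg =
    (λ r → φ r 0 , value r)
  , record
    { Q-infinite = Q-infinite
    ; degree     = λ q q∈Q → Graph.order (G q q∈Q)
    ; g-value    = λ q q∈Q → g-value (srg q q∈Q)
    ; f-degree   = λ q q∈Q → monic-degree {graphCharPoly (G q q∈Q)} (charPoly-monic (Graph.adjacencyMatrix (G q q∈Q)))
    ; φ          = λ r → φ r 0
    ; f-coeff    = λ q q∈Q r _ → value r q q∈Q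
    }
  where
  open CoefficientPolynomials v k l m
  value : ∀ r q q∈Q → coeffFromTop (Graph.order (G q q∈Q)) (graphCharPoly (G q q∈Q)) r ≡ eval (φ r 0) (fromℕ q)
  value r q q∈Q = coefficient-value (G q q∈Q) q (srg q q∈Q) r
  g-value : ∀ {G q} → IsStronglyRegularAt G v k l m q → eval v (fromℕ q) ≡ fromℕ (Graph.order G)
  g-value (_ , _ , _ , _ , v⇓ , _ , _ , _ , sr) = ≡.trans v⇓ (≡.cong fromℕ (≡.sym (IsStronglyRegular.order≡v sr)))
  monic-degree : ∀ {p d} → Leads (coeff p) d 1ℚ → HasDegree p d
  monic-degree (top , above) = (λ top≡0 → 1≢0 (≡.trans (≡.sym top) top≡0)) , above
    where
    1≢0 : 1ℚ ≢ 0ℚ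
    1≢0 ()
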